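{- There exists an $O(n\log n)$-time 2-approximation algorithm for the Maximum Bipartite Subgraph problem on a set of $n$ unit-height rectangles in the plane. That is, there is an algorithm which, given a set $S$ of $n$ unit-height rectangles, computes in $O(n\log n)$ time a subset $S'\subseteq S$ whose intersection graph is bipartite and such that $|S'|\ge |S^*|/2$, where $S^*\subseteq S$ is a maximum-size subset whose intersection graph is bipartite.
   Context: A unit-height rectangle is an axis-parallel rectangle of height 1 (and arbitrary width). The intersection graph of a set of rectangles has one vertex per rectangle, two vertices being adjacent if and only if the corresponding rectangles intersect. The Maximum Bipartite Subgraph problem asks for a maximum-size subset of the input whose intersection graph is bipartite. Running times count elementary operations, including arithmetic on real numbers, at unit cost. -}

module Defs where

open import Level using (0ℓ)
open import Algebra.Bundles using (CommutativeRing)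
open import Data.Bool.Base using (Bool; true; false; not; _∧_; if_then_else_)
open import Data.Fin.Base using (Fin; toℕ; fromℕ<)
open import Data.Fin.Subset using (Subset; _∈_; ∣_∣)
open import Data.Nat.Base using (ℕ; _+_; _*_; _∸_; _≤_; _≤ᵇ_; _≡ᵇ_)
open import Data.Nat.Properties using (_<?_)
open import Data.Product.Base using (Σ; ∃; ∃₂; ∃-syntax; _×_; _,_; proj₁)
open import Data.Vec.Base using (tabulate)
open import Function.Base using (_∘_)
open import Function.Definitions using (Injective)
open import Relation.Binary.Core using (Rel)
open import Relation.Binary.Definitions using (Symmetric; Irreflexive)
open import Relation.Binary.PropositionalEquality.Core using (_≡_; _≢_; refl; sym)
open import Relation.Binary.Structures using (IsDecTotalOrder)
open import Relation.Nullary.Decidable using (does; yes; no)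
open import Relation.Nullary.Negation using (¬_)

infix 4 _∈O_

_∈O_ : (ℕ → ℕ) → (ℕ → ℕ) → Set
f ∈O g = ∃₂ λ c n₀ → ∀ n → n₀ ≤ n → f n ≤ c * g n

-- The real numbers, axiomatised as a Dedekind-complete totally ordered field.
-- Comparisons are decidable because the real RAM performs them in one step.

record RealNumbers : Set₁ where
  field
    commutativeRing : CommutativeRing 0ℓ 0ℓ

  open CommutativeRing commutativeRing public
    using (Carrier; _≈_; 0#; 1#)
    renaming (_+_ to _+ᴿ_; _*_ to _*ᴿ_; _-_ to _-ᴿ_)

  infix 4 _≤ᴿ_ _<ᴿ_

  field
    _≤ᴿ_            : Rel Carrier 0ℓ
    isDecTotalOrder : IsDecTotalOrder _≈_ _≤ᴿ_
    +-monoˡ-≤       : ∀ z {x y} → x ≤ᴿ y → (x +ᴿ z) ≤ᴿ (y +ᴿ z)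
    *-nonNeg        : ∀ {x y} → 0# ≤ᴿ x → 0# ≤ᴿ y → 0# ≤ᴿ (x *ᴿ y)
    0≉1             : ¬ (0# ≈ 1#)
    -- Total for convenience; the value of 0# ⁻¹ is unspecified.
    _⁻¹             : Carrier → Carrier
    ⁻¹-cong         : ∀ {x y} → x ≈ y → (x ⁻¹) ≈ (y ⁻¹)
    *-inverseʳ      : ∀ x → ¬ (x ≈ 0#) → (x *ᴿ (x ⁻¹)) ≈ 1#

  open IsDecTotalOrder isDecTotalOrder public using () renaming (_≤?_ to _≤ᴿ?_)

  _<ᴿ_ : Rel Carrier 0ℓ
  x <ᴿ y = x ≤ᴿ y × ¬ (x ≈ y)

  UpperBound : (Carrier → Set) → Carrier → Set
  UpperBound P b = ∀ x → P x → x ≤ᴿ b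

  field
    complete : (P : Carrier → Set) → ∃ P → ∃ (UpperBound P) →
               ∃[ s ] UpperBound P s × (∀ b → UpperBound P b → s ≤ᴿ b)

record Graph : Set₁ where
  infix 4 _~_
  field
    Vertex   : Set
    _~_      : Rel Vertex 0ℓ
    ~-sym    : Symmetric _~_
    ~-irrefl : Irreflexive _≡_ _~_

Bipartite : Graph → Set
Bipartite G = Σ (Vertex → Bool) λ side → ∀ u v → u ~ v → side u ≢ side v
  where open Graph G

-- Programs for a real RAM.  Memory consists of arrays of natural numbers and
-- arrays of reals, each unboundedly long; an array is named by a numeral fixed
-- in the program text, while the index into it is computed at run time.  A
-- scalar variable is an array used at a constant index.

infixl 9  _⊠_ _⊘_
infixl 8  _⊕_ _⊖_ _⊞_ _⊟_
infix  7  _≤ⁿ_ _≤ʳ_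
infixr 6  _&_
infix  6  nat[_][_]≔_ real[_][_]≔_ ifᵖ_then_else_ while_loop_
infixr 5  _⨾_

data NatExp : Set where
  lit        : ℕ → NatExp
  nat[_][_]  : ℕ → NatExp → NatExp
  _⊕_ _⊖_    : NatExp → NatExp → NatExp

data RealExp : Set where
  zeroᴿ oneᴿ      : RealExp
  real[_][_]      : ℕ → NatExp → RealExp
  _⊞_ _⊟_ _⊠_ _⊘_ : RealExp → RealExp → RealExp

data BoolExp : Set where
  _≤ⁿ_ : NatExp → NatExp → BoolExp
  _≤ʳ_ : RealExp → RealExp → BoolExp
  notᵇ : BoolExp → BoolExp
  _&_  : BoolExp → BoolExp → BoolExp

data Program : Set where
  skip           : Program
  nat[_][_]≔_    : ℕ → NatExp → NatExp → Program
  real[_][_]≔_   : ℕ → NatExp → RealExp → Program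
  _⨾_            : Program → Program → Program
  ifᵖ_then_else_ : BoolExp → Program → Program → Program
  while_loop_    : BoolExp → Program → Program

-- Unit cost: every node of an expression is one elementary operation.

costⁿ : NatExp → ℕ
costⁿ (lit _)          = 1
costⁿ (nat[ _ ][ e ])  = 1 + costⁿ e
costⁿ (e ⊕ f)          = 1 + (costⁿ e + costⁿ f)
costⁿ (e ⊖ f)          = 1 + (costⁿ e + costⁿ f)

costʳ : RealExp → ℕ
costʳ zeroᴿ            = 1
costʳ oneᴿ             = 1
costʳ (real[ _ ][ e ]) = 1 + costⁿ e
costʳ (e ⊞ f)          = 1 + (costʳ e + costʳ f)
costʳ (e ⊟ f)          = 1 + (costʳ e + costʳ f)
costʳ (e ⊠ f)          = 1 + (costʳ e + costʳ f)
costʳ (e ⊘ f)          = 1 + (costʳ e + costʳ f)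

costᵇ : BoolExp → ℕ
costᵇ (e ≤ⁿ f) = 1 + (costⁿ e + costⁿ f)
costᵇ (e ≤ʳ f) = 1 + (costʳ e + costʳ f)
costᵇ (notᵇ b) = 1 + costᵇ b
costᵇ (b & c)  = 1 + (costᵇ b + costᵇ c)

_[_,_↦_] : {A : Set} → (ℕ → ℕ → A) → ℕ → ℕ → A → (ℕ → ℕ → A)
(m [ a , i ↦ x ]) b j = if (a ≡ᵇ b) ∧ (i ≡ᵇ j) then x else m b j

module RealRAM (ℝ : RealNumbers) where

  open RealNumbers ℝ

  record Memory : Set where
    constructor ⟪_,_⟫
    field
      natMem  : ℕ → ℕ → ℕ
      realMem : ℕ → ℕ → Carrier

  open Memory public

  evalⁿ : NatExp → Memory → ℕ
  evalⁿ (lit k)          σ = k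
  evalⁿ (nat[ a ][ e ])  σ = natMem σ a (evalⁿ e σ)
  evalⁿ (e ⊕ f)          σ = evalⁿ e σ + evalⁿ f σ
  evalⁿ (e ⊖ f)          σ = evalⁿ e σ ∸ evalⁿ f σ

  evalʳ : RealExp → Memory → Carrier
  evalʳ zeroᴿ            σ = 0#
  evalʳ oneᴿ             σ = 1#
  evalʳ (real[ a ][ e ]) σ = realMem σ a (evalⁿ e σ)
  evalʳ (e ⊞ f)          σ = evalʳ e σ +ᴿ evalʳ f σ
  evalʳ (e ⊟ f)          σ = evalʳ e σ -ᴿ evalʳ f σ
  evalʳ (e ⊠ f)          σ = evalʳ e σ *ᴿ evalʳ f σ
  evalʳ (e ⊘ f)          σ = evalʳ e σ *ᴿ (evalʳ f σ ⁻¹)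

  evalᵇ : BoolExp → Memory → Bool
  evalᵇ (e ≤ⁿ f) σ = evalⁿ e σ ≤ᵇ evalⁿ f σ
  evalᵇ (e ≤ʳ f) σ = does (evalʳ e σ ≤ᴿ? evalʳ f σ)
  evalᵇ (notᵇ b) σ = not (evalᵇ b σ)
  evalᵇ (b & c)  σ = evalᵇ b σ ∧ evalᵇ c σ

  -- p , σ ⇓ τ , t: started in memory σ, p halts in memory τ after t operations.

  infix 4 _,_⇓_,_

  data _,_⇓_,_ : Program → Memory → Memory → ℕ → Set where
    ⇓skip  : ∀ {σ} → skip , σ ⇓ σ , 1
    ⇓nat   : ∀ {σ a i e} →
             nat[ a ][ i ]≔ e , σ
               ⇓ ⟪ natMem σ [ a , evalⁿ i σ ↦ evalⁿ e σ ] , realMem σ ⟫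
               , 1 + (costⁿ i + costⁿ e)
    ⇓real  : ∀ {σ a i e} →
             real[ a ][ i ]≔ e , σ
               ⇓ ⟪ natMem σ , realMem σ [ a , evalⁿ i σ ↦ evalʳ e σ ] ⟫
               , 1 + (costⁿ i + costʳ e)
    ⇓seq   : ∀ {p q σ τ υ s t} →
             p , σ ⇓ τ , s → q , τ ⇓ υ , t → p ⨾ q , σ ⇓ υ , s + t
    ⇓true  : ∀ {b p q σ τ t} → evalᵇ b σ ≡ true →
             p , σ ⇓ τ , t → ifᵖ b then p else q , σ ⇓ τ , costᵇ b + t
    ⇓false : ∀ {b p q σ τ t} → evalᵇ b σ ≡ false →
             q , σ ⇓ τ , t → ifᵖ b then p else q , σ ⇓ τ , costᵇ b + t
    ⇓stop  : ∀ {b p σ} → evalᵇ b σ ≡ false →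
             while b loop p , σ ⇓ σ , costᵇ b
    ⇓loop  : ∀ {b p σ τ υ s t} → evalᵇ b σ ≡ true →
             p , σ ⇓ τ , s → while b loop p , τ ⇓ υ , t →
             while b loop p , σ ⇓ υ , costᵇ b + (s + t)

module Rectangles (ℝ : RealNumbers) where

  open RealNumbers ℝ
  open RealRAM ℝ public

  record UnitHeightRectangle : Set where
    field
      left right bottom : Carrier
      left<right        : left <ᴿ right

    top : Carrier
    top = bottom +ᴿ 1#

  open UnitHeightRectangle

  _≈ʳ_ : Rel UnitHeightRectangle 0ℓ
  r ≈ʳ s = left r ≈ left s × right r ≈ right s × bottom r ≈ bottom s

  -- Rectangles are closed: touching rectangles intersect.

  Contains : UnitHeightRectangle → Carrier → Carrier → Set
  Contains r x y = left r ≤ᴿ x × x ≤ᴿ right r × bottom r ≤ᴿ y × y ≤ᴿ top r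

  Intersect : Rel UnitHeightRectangle 0ℓ
  Intersect r s = ∃₂ λ x y → Contains r x y × Contains s x y

  record RectangleSet (n : ℕ) : Set where
    field
      rect     : Fin n → UnitHeightRectangle
      distinct : Injective _≡_ _≈ʳ_ rect

  open RectangleSet

  intersectionGraph : ∀ {n} → RectangleSet n → Subset n → Graph
  intersectionGraph {n} S T = record
    { Vertex   = Σ (Fin n) (_∈ T)
    ; _~_      = λ u v → proj₁ u ≢ proj₁ v × Intersect (rect S (proj₁ u)) (rect S (proj₁ v))
    ; ~-sym    = λ { (u≢v , x , y , p , q) → u≢v ∘ sym , x , y , q , p }
    ; ~-irrefl = λ { refl (u≢u , _) → u≢u refl }
    }

  BipartiteSubset : ∀ {n} → RectangleSet n → Subset n → Set
  BipartiteSubset S T = Bipartite (intersectionGraph S T)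

  MaximumBipartiteSubset : ∀ {n} → RectangleSet n → Subset n → Set
  MaximumBipartiteSubset S T =
    BipartiteSubset S T × (∀ U → BipartiteSubset S U → ∣ U ∣ ≤ ∣ T ∣)

  -- Input: natural array 0 holds n at index 0; real arrays 0, 1, 2 hold the
  -- left, right and bottom coordinates; all other cells are zero.

  coordinate : ∀ {n} → RectangleSet n → (UnitHeightRectangle → Carrier) → ℕ → Carrier
  coordinate {n} S f i with i <? n
  ... | yes i<n = f (rect S (fromℕ< i<n))
  ... | no  _   = 0#

  input : ∀ {n} → RectangleSet n → Memory
  input {n} S = ⟪ nats , reals ⟫
    where
    nats : ℕ → ℕ → ℕ
    nats 0 0 = n
    nats _ _ = 0

    reals : ℕ → ℕ → Carrier
    reals 0 = coordinate S left
    reals 1 = coordinate S right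
    reals 2 = coordinate S bottom
    reals _ = λ _ → 0#

  -- Output: rectangle i is selected iff natural array 1 holds 1 at index i.

  output : ∀ n → Memory → Subset n
  output n σ = tabulate λ i → natMem σ 1 (toℕ i) ≡ᵇ 1

{-# OPTIONS --safe #-}

-- Scan the rectangles by bottom edge and open a new class whenever the bottom exceeds
-- that of the first member of the current class by more than 1.  Rectangles of one
-- class all meet a common horizontal line, so within a class only the x-intervals
-- matter; rectangles of distinct classes of equal parity are disjoint.  Within each
-- class, the greedy that scans intervals by right end and puts each on the track with
-- the latest possible end yields a maximum two-colourable subset, so there are
-- at least as many accepted rectangles as in an optimal solution, and the majority
-- parity keeps at least half of them.
-- Both scans are driven by a tournament tree, which costs O(log n) per element.

module Submission where

open import Defs
open import Algebra.Bundles using (CommutativeRing)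
open import Data.Bool.Base using (Bool; true; false; not; _∧_; if_then_else_)
open import Data.Bool.Properties using (not-involutive)
open import Data.Empty using (⊥; ⊥-elim)
open import Data.Fin.Base using (Fin; zero; suc; toℕ; fromℕ<)
open import Data.Fin.Properties using (toℕ<n; toℕ-fromℕ<; fromℕ<-toℕ; toℕ-injective)
open import Data.Fin.Subset using (Subset; _∈_; ∣_∣)
open import Data.Fin.Subset.Properties using (_∈?_)
open import Data.Nat.Base
  using (ℕ; zero; suc; _+_; _*_; _∸_; _^_; _≤_; _<_; _≤ᵇ_; _≡ᵇ_; z≤n; s≤s; s≤s⁻¹)
open import Data.Nat.Logarithm using (⌊log₂_⌋; ⌊log₂⌋-mono-≤; ⌊log₂[2^n]⌋≡n)
open import Data.Nat.Properties
open import Data.Nat.Tactic.RingSolver using (solve-∀)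
open import Data.Product.Base using (∃-syntax; _×_; _,_; proj₁; proj₂)
open import Data.Sum.Base using (_⊎_; inj₁; inj₂; [_,_]′)
open import Data.Vec.Base using ([]; _∷_; lookup)
open import Data.Vec.Properties using (lookup∘tabulate; lookup⇒[]=; []=⇒lookup)
open import Function.Base using (_∘_; id)
open import Relation.Binary.Definitions using (tri<; tri≈; tri>)
open import Relation.Binary.PropositionalEquality.Core
  using (_≡_; _≢_; refl; sym; trans; cong; cong₂; subst; subst₂)
open import Relation.Binary.Structures using (IsDecTotalOrder)
open import Relation.Nullary.Decidable using (Dec; does; yes; no)
open import Relation.Nullary.Negation using (¬_)

-- Forgetting intersections between different classes only enlarges the set of admissible solutions.
-- A two-colouring of an optimal subset therefore stays valid for the relaxed conflict relation
-- `blocks`, and a single greedy over all classes can be compared with it. The obstacle in the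
-- comparison is that both track ends of the greedy cannot be kept better than the rival's:
-- accepting an element that the rival skips makes an end worse. `Ahead` is the potential that
-- survives, trading cardinality against ends. Both scans are instances of one verified tournament,
-- parametrised by the comparison, the visiting program and its invariant. The language has neither
-- division nor remainder on naturals, so parents in the tree are looked up in a table and parities
-- are obtained by flipping. Running time is part of the program logic: every verified program
-- carries a bound read off from its text and its iteration counts.

true≢false : ∀ {b} → b ≡ true → b ≡ false → ⊥
true≢false refl ()

≤ᵇ-true : ∀ {m n} → (m ≤ᵇ n) ≡ true → m ≤ n
≤ᵇ-true {m} {n} eq = ≤ᵇ⇒≤ m n (subst Data.Bool.Base.T (sym eq) _)

true-≤ᵇ : ∀ {m n} → m ≤ n → (m ≤ᵇ n) ≡ true
true-≤ᵇ {m} {n} m≤n with m ≤ᵇ n | ≤⇒≤ᵇ m≤n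
... | true | _ = refl

≤ᵇ-false : ∀ {m n} → (m ≤ᵇ n) ≡ false → n < m
≤ᵇ-false eq = ≰⇒> λ m≤n → true≢false (true-≤ᵇ m≤n) eq

≡ᵇ-refl : ∀ n → (n ≡ᵇ n) ≡ true
≡ᵇ-refl zero    = refl
≡ᵇ-refl (suc n) = ≡ᵇ-refl n

≢⇒≡ᵇ-false : ∀ {m n} → m ≢ n → (m ≡ᵇ n) ≡ false
≢⇒≡ᵇ-false {m} {n} m≢n with m ≡ᵇ n in eq
... | false = refl
... | true  = ⊥-elim (m≢n (≡ᵇ⇒≡ m n (subst Data.Bool.Base.T (sym eq) _)))

≡ᵇ-true : ∀ {m n} → (m ≡ᵇ n) ≡ true → m ≡ n
≡ᵇ-true {m} {n} eq = ≡ᵇ⇒≡ m n (subst Data.Bool.Base.T (sym eq) _)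

-- Updated functions, counting and halving

set : {A : Set} → (ℕ → A) → ℕ → A → ℕ → A
set f i x j = if i ≡ᵇ j then x else f j

set-hit : ∀ {A : Set} (f : ℕ → A) i {x} → set f i x i ≡ x
set-hit f i rewrite ≡ᵇ-refl i = refl

set-miss : ∀ {A : Set} (f : ℕ → A) {i j x} → i ≢ j → set f i x j ≡ f j
set-miss f i≢j rewrite ≢⇒≡ᵇ-false i≢j = refl

insert : ℕ → (ℕ → Bool) → ℕ → Bool
insert t D = set D t true

insert⁻ : ∀ t D s → insert t D s ≡ true → s ≡ t ⊎ (s ≢ t × D s ≡ true)
insert⁻ t D s h with t ≟ s
... | yes refl = inj₁ refl
... | no t≢s   = inj₂ (t≢s ∘ sym , trans (sym (set-miss D t≢s)) h)

bit : Bool → ℕ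
bit false = 0
bit true  = 1

count : ℕ → (ℕ → Bool) → ℕ
count zero    f = 0
count (suc n) f = bit (f 0) + count n (f ∘ suc)

count-cong : ∀ n {f g : ℕ → Bool} → (∀ s → s < n → f s ≡ g s) → count n f ≡ count n g
count-cong zero    h = refl
count-cong (suc n) h = cong₂ _+_ (cong bit (h 0 (s≤s z≤n))) (count-cong n λ s s<n → h (suc s) (s≤s s<n))

count-const-true : ∀ n → count n (λ _ → true) ≡ n
count-const-true zero    = refl
count-const-true (suc n) = cong suc (count-const-true n)

count-const-false : ∀ n → count n (λ _ → false) ≡ 0
count-const-false zero    = refl
count-const-false (suc n) = count-const-false n

count-update : ∀ {n t} (f g : ℕ → Bool) → t < n → (∀ s → s ≢ t → f s ≡ g s) → g t ≡ false →
               count n f ≡ bit (f t) + count n g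
count-update {suc n} {zero} f g _ f≗g gt rewrite gt =
  cong (bit (f 0) +_) (count-cong n λ s _ → f≗g (suc s) λ ())
count-update {suc n} {suc t} f g (s≤s t<n) f≗g gt
  rewrite count-update (f ∘ suc) (g ∘ suc) t<n (λ s s≢t → f≗g (suc s) (s≢t ∘ suc-injective)) gt
        | f≗g 0 λ ()
  = x∙yz≈y∙xz (bit (g 0)) (bit (f (suc t))) (count n (g ∘ suc))
  where open import Algebra.Properties.CommutativeSemigroup +-commutativeSemigroup using (x∙yz≈y∙xz)

double-injective : ∀ {m n} → m + m ≡ n + n → m ≡ n
double-injective {zero}  {zero}  _ = refl
double-injective {suc m} {suc n} h =
  cong suc (double-injective (suc-injective (trans (sym (+-suc m m)) (trans (suc-injective h) (+-suc n n)))))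

m+m≢1+n+n : ∀ m n → m + m ≢ suc (n + n)
m+m≢1+n+n (suc m) zero    h with () ← trans (sym (+-suc m m)) (suc-injective h)
m+m≢1+n+n (suc m) (suc n) h =
  m+m≢1+n+n m n (suc-injective (trans (sym (+-suc m m)) (trans (suc-injective h) (cong suc (+-suc n n)))))

-- The floor of the half as a relation: matching on it tells a left child from a right child and
-- fixes the index at the same time.
data Halved : ℕ → ℕ → Set where
  even : ∀ p → Halved p (p + p)
  odd  : ∀ p → Halved p (suc (p + p))

halve : ∀ j → ∃[ p ] Halved p j
halve zero = 0 , even 0
halve (suc j) with halve j
... | p , even _ = p , odd p
... | p , odd _  = suc p , subst (Halved (suc p)) (cong suc (+-suc p p)) (even (suc p))

double≤halved : ∀ {p j} → Halved p j → p + p ≤ j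
double≤halved (even _) = ≤-refl
double≤halved (odd _)  = n≤1+n _

double-<-cancel : ∀ {m n} → m + m < n + n → m < n
double-<-cancel {m} {n} h = ≰⇒> λ n≤m → <⇒≱ h (+-mono-≤ n≤m n≤m)

halved-< : ∀ {p j n} → Halved p j → j < n + n → p < n
halved-< h j< = double-<-cancel (≤-<-trans (double≤halved h) j<)

-- Only meaningful for loop-free programs; both branches of a conditional are charged.
flatCost : Program → ℕ
flatCost skip                     = 1
flatCost (nat[ _ ][ i ]≔ e)       = 1 + (costⁿ i + costⁿ e)
flatCost (real[ _ ][ i ]≔ e)      = 1 + (costⁿ i + costʳ e)
flatCost (p ⨾ q)                  = flatCost p + flatCost q
flatCost (ifᵖ b then p else q)    = costᵇ b + (flatCost p + flatCost q)
flatCost (while _ loop _)         = 0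

-- A program logic with time bounds

module Machine (ℝ : RealNumbers) (ρ : ℕ → ℕ → RealNumbers.Carrier ℝ) where

  open RealRAM ℝ

  Nats : Set
  Nats = ℕ → ℕ → ℕ

  value : NatExp → Nats → ℕ
  value e m = evalⁿ e ⟪ m , ρ ⟫

  holds : BoolExp → Nats → Bool
  holds b m = evalᵇ b ⟪ m , ρ ⟫

  -- The programs verified here never write to real memory, so it stays equal to ρ.
  record Run (p : Program) (m : Nats) (c : ℕ) (Q : Nats → Set) : Set where
    constructor run
    field
      {final}   : Nats
      {elapsed} : ℕ
      halts     : p , ⟪ m , ρ ⟫ ⇓ ⟪ final , ρ ⟫ , elapsed
      within    : elapsed ≤ c
      post      : Q final

  private variable
    p q : Program
    m   : Nats
    c d : ℕ
    P Q : Nats → Set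

  run-mono : (∀ m → P m → Q m) → Run p m c P → Run p m c Q
  run-mono f (run h w x) = run h w (f _ x)

  run-skip : Q m → Run skip m 1 Q
  run-skip = run ⇓skip ≤-refl

  run-≔ : ∀ {a i e i′ x} → value i m ≡ i′ → value e m ≡ x →
          Q (m [ a , i′ ↦ x ]) → Run (nat[ a ][ i ]≔ e) m (1 + (costⁿ i + costⁿ e)) Q
  run-≔ refl refl = run ⇓nat ≤-refl

  -- The postcondition of `p` is itself a `Run` of `q`, so programs are verified by nesting
  -- continuations and the costs add up in the shape of the syntax.
  run-⨾ : Run p m c (λ m′ → Run q m′ d Q) → Run (p ⨾ q) m (c + d) Q
  run-⨾ (run h w (run h′ w′ x)) = run (⇓seq h h′) (+-mono-≤ w w′) x

  run-if : ∀ {b β} → holds b m ≡ β →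
           (β ≡ true → Run p m c Q) → (β ≡ false → Run q m d Q) →
           Run (ifᵖ b then p else q) m (costᵇ b + (c + d)) Q
  run-if {b = b} {true} e f _ with f refl
  ... | run h w x = run (⇓true e h) (+-monoʳ-≤ (costᵇ b) (m≤n⇒m≤n+o _ w)) x
  run-if {b = b} {false} e _ g with g refl
  ... | run h w x = run (⇓false e h) (+-monoʳ-≤ (costᵇ b) (m≤n⇒m≤o+n _ w)) x

  -- The index of `I` bounds the remaining iterations without having to be their exact number:
  -- whenever the guard holds it must be a successor. The last summand pays for the failing test.
  run-while : ∀ {b} (I : ℕ → Nats → Set) →
              (∀ {r m} → I r m → holds b m ≡ true →
                 ∃[ r′ ] r ≡ suc r′ × Run p m c (I r′)) →
              (∀ {r m} → I r m → holds b m ≡ false → Q m) →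
              ∀ {r m} → I r m → Run (while b loop p) m (r * (costᵇ b + c) + costᵇ b) Q
  run-while {c = c} {b = b} I step stop {r} {m} inv with holds b m in eq
  ... | false = run (⇓stop eq) (m≤n+m _ (r * _)) (stop inv eq)
  ... | true with r , refl , run h w x ← step inv eq
             with run h′ w′ y ← run-while I step stop x
      = run (⇓loop eq h h′)
            (≤-trans (+-monoʳ-≤ (costᵇ b) (+-mono-≤ w w′))
                     (≤-reflexive (rearrange (costᵇ b) c (r * (costᵇ b + c)))))
            y
    where
    rearrange : ∀ x y z → x + (y + (z + x)) ≡ x + y + z + x
    rearrange = solve-∀

-- The tournament tree as a program

-- Natural arrays: 2 the tree, 3 the halving table, 4 the tree pointer,
-- 5 the element being visited.  Elements are numbered 1, …, n, and 0 stands for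
-- "no element".  The tree has N = n + 1 leaves; leaf N + s holds s until s is
-- removed, and each internal node p < N holds the better of its children 2p, 2p + 1.

tree half : NatExp → NatExp
tree = nat[ 2 ][_]
half = nat[ 3 ][_]

pointer current leaves : NatExp
pointer = nat[ 4 ][ lit 0 ]
current = nat[ 5 ][ lit 0 ]
leaves  = lit 1 ⊕ nat[ 0 ][ lit 0 ]

leftChild rightChild : NatExp
leftChild  = pointer ⊕ pointer
rightChild = lit 1 ⊕ (pointer ⊕ pointer)

-- `BoolExp` has no disjunction, so "`b` is absent, or `a` is present and comes first" is written by
-- De Morgan. The absent element 0 thus loses against every present one.
betterᵉ : (NatExp → NatExp → BoolExp) → NatExp → NatExp → BoolExp
betterᵉ cmp a b = notᵇ ((lit 1 ≤ⁿ b) & notᵇ ((lit 1 ≤ⁿ a) & cmp a b))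

module _ (cmp : NatExp → NatExp → BoolExp) where

  play : Program
  play = ifᵖ betterᵉ cmp (tree leftChild) (tree rightChild)
         then nat[ 2 ][ pointer ]≔ tree leftChild
         else nat[ 2 ][ pointer ]≔ tree rightChild

  -- The countdown includes the index 0. The match played there is never consulted, but that pass
  -- records 0 as the half of 1, the value at which sifting stops.
  buildStep : Program
  buildStep =
    nat[ 4 ][ lit 0 ]≔ pointer ⊖ lit 1 ⨾
    nat[ 3 ][ leftChild ]≔ pointer ⨾
    nat[ 3 ][ rightChild ]≔ pointer ⨾
    (ifᵖ leaves ≤ⁿ pointer then nat[ 2 ][ pointer ]≔ pointer ⊖ leaves else play)

  siftStep : Program
  siftStep = play ⨾ nat[ 4 ][ lit 0 ]≔ half pointer

  module _ (visit : Program) where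

    extractStep : Program
    extractStep =
      nat[ 5 ][ lit 0 ]≔ tree (lit 1) ⨾
      visit ⨾
      nat[ 2 ][ leaves ⊕ current ]≔ lit 0 ⨾
      nat[ 4 ][ lit 0 ]≔ half (leaves ⊕ current) ⨾
      while lit 1 ≤ⁿ pointer loop siftStep

    tournament : Program
    tournament =
      nat[ 4 ][ lit 0 ]≔ leaves ⊕ leaves ⨾
      while lit 1 ≤ⁿ pointer loop buildStep ⨾
      while lit 1 ≤ⁿ tree (lit 1) loop extractStep

module _ (cmp : NatExp → NatExp → BoolExp) where

  siftLoopCost : ℕ → ℕ
  siftLoopCost K =
    K * (costᵇ (lit 1 ≤ⁿ pointer) + flatCost (siftStep cmp)) + costᵇ (lit 1 ≤ⁿ pointer)

  extractCost : (visitCost K : ℕ) → ℕ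
  extractCost visitCost K = 4 + (visitCost + (9 + (10 + siftLoopCost K)))

  tournamentCost : (visitCost n K : ℕ) → ℕ
  tournamentCost visitCost n K =
    11 + (((suc n + suc n) * (costᵇ (lit 1 ≤ⁿ pointer) + flatCost (buildStep cmp)) + costᵇ (lit 1 ≤ⁿ pointer))
       + (suc n * (costᵇ (lit 1 ≤ⁿ tree (lit 1)) + extractCost visitCost K) + costᵇ (lit 1 ≤ⁿ tree (lit 1))))

-- Correctness of the tournament

data Private : ℕ → Set where
  treeᵖ    : Private 2
  halfᵖ    : Private 3
  pointerᵖ : Private 4
  currentᵖ : Private 5

-- `J D m` is the visitor's invariant once the set `D` has been visited; it has to survive the
-- tournament's own writes, those to `Private` arrays. `cmp-correct` may assume it because the
-- second scan compares by classes stored in memory, and the invariant is what fixes them.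
module Tournament
  (ℝ : RealNumbers) (ρ : ℕ → ℕ → RealNumbers.Carrier ℝ) (n : ℕ)
  (cmp : NatExp → NatExp → BoolExp)
  (le : ℕ → ℕ → Bool)
  (le-trans : ∀ {a b c} → le a b ≡ true → le b c ≡ true → le a c ≡ true)
  (le-total : ∀ a b → le a b ≡ true ⊎ le b a ≡ true)
  (J : (ℕ → Bool) → (ℕ → ℕ → ℕ) → Set)
  (stable : ∀ {D m a} → Private a → ∀ i x → J D m → J D (m [ a , i ↦ x ]))
  (cmp-correct : ∀ {D m} → J D m → ∀ a b →
     Machine.holds ℝ ρ (cmp a b) m ≡ le (Machine.value ℝ ρ a m) (Machine.value ℝ ρ b m))
  (visit : Program) (visitCost : ℕ)
  (visit-correct : ∀ {D m t} → J D m → m 5 0 ≡ t → 1 ≤ t → t ≤ n → D t ≡ false →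
     (∀ s → D s ≡ true → le s t ≡ true) →
     Machine.Run ℝ ρ visit m visitCost λ m′ →
       J (insert t D) m′ × m′ 0 ≡ m 0 × m′ 2 ≡ m 2 × m′ 3 ≡ m 3 × m′ 5 ≡ m 5)
  where

  open Machine ℝ ρ

  N : ℕ
  N = suc n

  better : ℕ → ℕ → Bool
  better a b = not ((1 ≤ᵇ b) ∧ not ((1 ≤ᵇ a) ∧ le a b))

  le-better : ∀ {a b} → 1 ≤ a → le a b ≡ true → better a b ≡ true
  le-better {suc a} {zero}  _ h = refl
  le-better {suc a} {suc b} _ h rewrite h = refl

  better-le : ∀ {a b} → 1 ≤ b → better a b ≡ true → 1 ≤ a × le a b ≡ true
  better-le {suc a} {suc b} _ h with le (suc a) (suc b)
  ... | true = s≤s z≤n , refl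

  better-refl : ∀ a → better a a ≡ true
  better-refl zero    = refl
  better-refl (suc a) = le-better (s≤s z≤n) ([ id , id ]′ (le-total (suc a) (suc a)))

  better-trans : ∀ {a b c} → better a b ≡ true → better b c ≡ true → better a c ≡ true
  better-trans {c = zero}  _ _ = refl
  better-trans {c = suc c} h k with 1≤b , b≤c ← better-le (s≤s z≤n) k
    with 1≤a , a≤b ← better-le 1≤b h = le-better 1≤a (le-trans a≤b b≤c)

  better-total : ∀ a b → better a b ≡ false → better b a ≡ true
  better-total zero    (suc b) h = refl
  better-total (suc a) (suc b) h with le-total (suc a) (suc b)
  ... | inj₁ a≤b = ⊥-elim (true≢false (le-better (s≤s z≤n) a≤b) h)
  ... | inj₂ b≤a = le-better (s≤s z≤n) b≤a

  -- Being one of the two traces the root back to a leaf; being at least as good as both makes the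
  -- root minimal.
  Wins : ℕ → ℕ → ℕ → Set
  Wins x a b = (x ≡ a ⊎ x ≡ b) × better x a ≡ true × better x b ≡ true

  Settled : (ℕ → ℕ) → ℕ → Set
  Settled T p = Wins (T p) (T (p + p)) (T (suc (p + p)))

  settled-set : ∀ {T p j x} → j ≢ p → j ≢ p + p → j ≢ suc (p + p) →
                Settled T p → Settled (set T j x) p
  settled-set {T} {p} {j} {x} a b c w
    rewrite set-miss T {x = x} a | set-miss T {x = x} b | set-miss T {x = x} c = w

  p≢p+p : ∀ {p} → 1 ≤ p → p ≢ p + p
  p≢p+p {suc p} _ h with () ← m≢1+m+n (suc p) (trans h (+-suc (suc p) p))

  p≢1+p+p : ∀ {p} → p ≢ suc (p + p)
  p≢1+p+p {p} h = m≢1+m+n p h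

  settled-wins : ∀ {T p x} → 1 ≤ p → Wins x (T (p + p)) (T (suc (p + p))) →
                 Settled (set T p x) p
  settled-wins {T} {p} {x} 1≤p w
    rewrite set-hit T p {x}
          | set-miss T {x = x} (p≢p+p 1≤p)
          | set-miss T {x = x} (p≢1+p+p {p}) = w

  play-correct : ∀ {D m p} → J D m → m 4 0 ≡ p →
    Run (play cmp) m (flatCost (play cmp)) λ m′ →
      ∃[ x ] Wins x (m 2 (p + p)) (m 2 (suc (p + p))) × m′ ≡ m [ 2 , p ↦ x ]
  play-correct {m = m} {p} j refl =
    run-if eval
      (λ h → run-≔ refl refl (_ , (inj₁ refl , better-refl (m 2 (p + p)) , h) , refl))
      (λ h → run-≔ refl refl
         (_ , (inj₂ refl , better-total (m 2 (p + p)) _ h , better-refl (m 2 (suc (p + p)))) , refl))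
    where
    eval : holds (betterᵉ cmp (tree leftChild) (tree rightChild)) m
           ≡ better (m 2 (p + p)) (m 2 (suc (p + p)))
    eval rewrite cmp-correct j (tree leftChild) (tree rightChild) = refl

  HalvesFrom : ℕ → (ℕ → ℕ) → Set
  HalvesFrom i H = ∀ {p j} → i ≤ p → p < N + N → Halved p j → H j ≡ p

  halved-injective : ∀ {p q j} → Halved p j → Halved q j → p ≡ q
  halved-injective h k = go h k refl
    where
    go : ∀ {p q j k} → Halved p j → Halved q k → j ≡ k → p ≡ q
    go (even p) (even q) e = double-injective e
    go (even p) (odd q)  e = ⊥-elim (m+m≢1+n+n p q e)
    go (odd p)  (even q) e = ⊥-elim (m+m≢1+n+n q p (sym e))
    go (odd p)  (odd q)  e = double-injective (suc-injective e)

  halves-step : ∀ {i H} → HalvesFrom (suc i) H →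
                HalvesFrom i (set (set H (i + i) i) (suc (i + i)) i)
  halves-step {i} {H} h {p} {j} i≤p p< hj with suc (i + i) ≟ j
  ... | yes refl = trans (set-hit (set H (i + i) i) (suc (i + i))) (halved-injective (odd i) hj)
  ... | no ≢j with i + i ≟ j
  ...   | yes refl = trans (set-miss (set H (i + i) i) ≢j)
                       (trans (set-hit H (i + i)) (halved-injective (even i) hj))
  ...   | no ≢j′ = trans (set-miss (set H (i + i) i) ≢j) (trans (set-miss H ≢j′)
                     (h (≤∧≢⇒< i≤p (i≢p hj)) p< hj))
    where
    i≢p : Halved p j → i ≢ p
    i≢p (even _) refl = ≢j′ refl
    i≢p (odd _)  refl = ≢j refl

  none : ℕ → Bool
  none _ = false

  record Building (i : ℕ) (m : Nats) : Set where
    field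
      at      : m 4 0 ≡ i
      bound   : i ≤ N + N
      size    : m 0 0 ≡ n
      user    : J none m
      halves  : HalvesFrom i (m 3)
      leaf    : ∀ s → s < N → i ≤ N + s → m 2 (N + s) ≡ s
      settled : ∀ p → i ≤ p → 1 ≤ p → p < N → Settled (m 2) p

  build-correct : ∀ {i m} → Building (suc i) m → Run (buildStep cmp) m (flatCost (buildStep cmp)) (Building i)
  build-correct {i} {m} b =
    run-⨾ (run-≔ {x = i} refl (cong (_∸ 1) at)
    (run-⨾ (run-≔ refl refl
    (run-⨾ (run-≔ refl refl
    (run-if {β = N ≤ᵇ i} (cong (λ k → suc k ≤ᵇ i) size)
      (λ N≤i → run-≔ refl (cong (λ k → i ∸ suc k) size) (leafCase (≤ᵇ-true N≤i)))
      (λ N≰i → run-mono (internalCase (≤ᵇ-false N≰i)) (play-correct user₃ refl))))))))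
    where
    open Building b
    m₃ : Nats
    m₃ = ((m [ 4 , 0 ↦ i ]) [ 3 , i + i ↦ i ]) [ 3 , suc (i + i) ↦ i ]
    user₃ : J none m₃
    user₃ = stable halfᵖ (suc (i + i)) i (stable halfᵖ (i + i) i (stable pointerᵖ 0 i user))
    leafCase : N ≤ i → Building i (m₃ [ 2 , i ↦ i ∸ N ])
    leafCase N≤i = record
      { at = refl ; bound = ≤-trans (n≤1+n i) bound ; size = size
      ; user = stable treeᵖ i (i ∸ N) user₃
      ; halves = halves-step halves
      ; leaf = leaf′
      ; settled = λ p i≤p _ p<N → ⊥-elim (<⇒≱ p<N (≤-trans N≤i i≤p))
      }
      where
      leaf′ : ∀ s → s < N → i ≤ N + s → set (m 2) i (i ∸ N) (N + s) ≡ s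
      leaf′ s s<N i≤ with i ≟ N + s
      ... | yes refl = trans (set-hit (m 2) (N + s)) (m+n∸m≡n N s)
      ... | no i≢    = trans (set-miss (m 2) i≢) (leaf s s<N (≤∧≢⇒< i≤ i≢))
    internalCase : i < N → ∀ m′ → (∃[ x ] Wins x (m 2 (i + i)) (m 2 (suc (i + i))) × m′ ≡ m₃ [ 2 , i ↦ x ]) →
                   Building i m′
    internalCase i<N _ (x , w , refl) = record
      { at = refl ; bound = ≤-trans (n≤1+n i) bound ; size = size
      ; user = stable treeᵖ i x user₃
      ; halves = halves-step halves
      ; leaf = leaf′
      ; settled = settled′
      }
      where
      leaf′ : ∀ s → s < N → i ≤ N + s → set (m 2) i x (N + s) ≡ s
      leaf′ s s<N i≤ =
        trans (set-miss (m 2) (<⇒≢ i<N+s)) (leaf s s<N i<N+s)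
        where
        i<N+s : i < N + s
        i<N+s = ≤-trans i<N (m≤m+n N s)
      settled′ : ∀ p → i ≤ p → 1 ≤ p → p < N → Settled (set (m 2) i x) p
      settled′ p i≤p 1≤p p<N with i ≟ p
      ... | yes refl = settled-wins {m 2} 1≤p w
      ... | no i≢p = settled-set {m 2} i≢p
              (<⇒≢ (≤-trans i<p (m≤m+n p p)))
              (<⇒≢ (m≤n⇒m≤1+n (≤-trans i<p (m≤m+n p p)))) (settled p i<p 1≤p p<N)
        where
        i<p : i < p
        i<p = ≤∧≢⇒< i≤p i≢p

  Leaves : (ℕ → Bool) → (ℕ → ℕ) → Set
  Leaves D T = ∀ s → s < N → T (N + s) ≡ (if D s then 0 else s)

  record Ready (D : ℕ → Bool) (m : Nats) : Set where
    field
      size    : m 0 0 ≡ n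
      user    : J D m
      halves  : HalvesFrom 0 (m 3)
      leaf    : Leaves D (m 2)
      settled : ∀ p → 1 ≤ p → p < N → Settled (m 2) p

  -- `settled` exempts only the node under the pointer, the match that is to be replayed next.
  -- `shallow` bounds the climb: the pointer is halved in each step, so at most `r` replays remain.
  record Sifting (D : ℕ → Bool) (r : ℕ) (m : Nats) : Set where
    field
      shallow : m 4 0 < 2 ^ r
      inner   : m 4 0 < N
      size    : m 0 0 ≡ n
      user    : J D m
      halves  : HalvesFrom 0 (m 3)
      leaf    : Leaves D (m 2)
      settled : ∀ p → 1 ≤ p → p < N → m 4 0 ≢ p → Settled (m 2) p

  -- Rewriting a node can spoil no match above it except the one at its parent, and that is where
  -- the pointer moves.
  sift-correct : ∀ {D r m} → Sifting D r m → 1 ≤ m 4 0 →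
    ∃[ r′ ] r ≡ suc r′ × Run (siftStep cmp) m (flatCost (siftStep cmp)) (Sifting D r′)
  sift-correct {r = zero} s 1≤i = ⊥-elim (<⇒≱ (Sifting.shallow s) 1≤i)
  sift-correct {D} {suc r} {m} s 1≤i = r , refl ,
    run-⨾ (run-mono (λ { _ (x , w , refl) → run-≔ {x = m 3 i} refl refl (sifted w) })
                    (play-correct user refl))
    where
    open Sifting s
    i h : ℕ
    i = m 4 0
    h = proj₁ (halve i)
    h-halves : Halved h i
    h-halves = proj₂ (halve i)
    h≤i : h ≤ i
    h≤i = ≤-trans (m≤m+n h h) (double≤halved h-halves)
    parent : m 3 i ≡ h
    parent = halves z≤n (≤-trans (≤-<-trans h≤i inner) (m≤m+n N N)) h-halves
    sifted : ∀ {x} → Wins x (m 2 (i + i)) (m 2 (suc (i + i))) →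
             Sifting D r ((m [ 2 , i ↦ x ]) [ 4 , 0 ↦ m 3 i ])
    sifted {x} w = record
      { shallow = subst (_< 2 ^ r) (sym parent)
                    (halved-< h-halves (subst (i <_) (cong (2 ^ r +_) (+-identityʳ (2 ^ r))) shallow))
      ; inner   = subst (_< N) (sym parent) (≤-<-trans h≤i inner)
      ; size    = size
      ; user    = stable pointerᵖ 0 (m 3 i) (stable treeᵖ i x user)
      ; halves  = halves
      ; leaf    = λ s s<N → trans (set-miss (m 2) (<⇒≢ (≤-trans inner (m≤m+n N s)))) (leaf s s<N)
      ; settled = settled′
      }
      where
      settled′ : ∀ p → 1 ≤ p → p < N → m 3 i ≢ p → Settled (set (m 2) i x) p
      settled′ p 1≤p p<N h≢p with i ≟ p
      ... | yes refl = settled-wins {m 2} 1≤p w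
      ... | no i≢p   = settled-set {m 2} i≢p (λ i≡ → h≢p (halves′ (subst (Halved p) (sym i≡) (even p))))
                         (λ i≡ → h≢p (halves′ (subst (Halved p) (sym i≡) (odd p))))
                         (settled p 1≤p p<N i≢p)
        where
        halves′ : Halved p i → m 3 i ≡ p
        halves′ = halves z≤n (≤-trans p<N (m≤m+n N N))

  -- Once the pointer is 0, the exemption in `Sifting` concerns no node `p` with `1 ≤ p`.
  sift-loop : ∀ {D K m} → Sifting D K m →
    Run (while lit 1 ≤ⁿ pointer loop siftStep cmp) m (siftLoopCost cmp K) (Ready D)
  sift-loop {D} = run-while (Sifting D) (λ s g → sift-correct s (≤ᵇ-true g)) λ s g →
    let open Sifting s in record
      { size = size ; user = user ; halves = halves ; leaf = leaf
      ; settled = λ p 1≤p p<N → settled p 1≤p p<N (<⇒≢ (<-≤-trans (≤ᵇ-false g) 1≤p)) }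

  module _ {D m} (ready : Ready D m) where
    open Ready ready

    private
      T : ℕ → ℕ
      T = m 2

    -- Climb from `j` to its parent, which is at least as good by its match, until the root is
    -- reached. Halving is not structural recursion, hence the bound `k`.
    root-best : ∀ k {j} → j ≤ k → 1 ≤ j → j < N + N → better (T 1) (T j) ≡ true
    root-best k {1} _ _ _ = better-refl (T 1)
    root-best (suc k) {j@(suc (suc _))} j≤k _ j< with halve j
    ... | h , hj = better-trans {T 1} {T h} {T j} (root-best k h≤k 1≤h (≤-trans h<N (m≤m+n N N))) (beats hj)
      where
      1≤h : 1 ≤ h
      1≤h = n≢0⇒n>0 λ { refl → case0 hj }
        where
        case0 : ∀ {i} → Halved 0 (suc (suc i)) → ⊥
        case0 ()
      h<N : h < N
      h<N = halved-< hj j<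
      h≤k : h ≤ k
      h≤k = s≤s⁻¹ (≤-trans (≤-trans (+-monoˡ-≤ h 1≤h) (double≤halved hj)) j≤k)
      beats : ∀ {i} → Halved h i → better (T h) (T i) ≡ true
      beats (even _) = proj₁ (proj₂ (settled h 1≤h h<N))
      beats (odd _)  = proj₂ (proj₂ (settled h 1≤h h<N))

    -- Follow the winning child downwards. Its index exceeds that of its parent, so the distance to
    -- `N` bounds the descent.
    node-is-leaf : ∀ k {j} → 1 ≤ j → j < N + N → N ≤ j + k → ∃[ s ] s < N × T j ≡ T (N + s)
    node-is-leaf k {j} 1≤j j< j+k with N ≤? j
    ... | yes N≤j = j ∸ N , +-cancelˡ-< N (j ∸ N) N (subst (_< N + N) (sym (m+[n∸m]≡n N≤j)) j<)
                  , cong T (sym (m+[n∸m]≡n N≤j))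
    node-is-leaf zero {j} 1≤j j< j+k | no N≰j = ⊥-elim (N≰j (subst (N ≤_) (+-identityʳ j) j+k))
    node-is-leaf (suc k) {j} 1≤j j< j+k | no N≰j with proj₁ (settled j 1≤j (≰⇒> N≰j))
    ... | inj₁ e with s , s<N , e′ ← node-is-leaf k (≤-trans 1≤j (m≤m+n j j))
                       (+-mono-< (≰⇒> N≰j) (≰⇒> N≰j))
                       (≤-trans j+k (subst (_≤ j + j + k) (sym (+-suc j k)) (+-monoˡ-≤ k (+-monoˡ-≤ j 1≤j))))
      = s , s<N , trans e e′
    ... | inj₂ e with s , s<N , e′ ← node-is-leaf k (s≤s z≤n)
                       (s≤s (≤-trans (≤-reflexive (sym (+-suc j j))) (+-mono-≤ (s≤s⁻¹ (≰⇒> N≰j)) (≰⇒> N≰j))))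
                       (≤-trans j+k (subst (_≤ suc (j + j) + k) (sym (+-suc j k)) (s≤s (+-monoˡ-≤ k (m≤m+n j j)))))
      = s , s<N , trans e e′

    root-present : 1 ≤ T 1 → T 1 < N × D (T 1) ≡ false
    root-present 1≤ with node-is-leaf N (s≤s z≤n) (s≤s (≤-trans (s≤s z≤n) (m≤n+m N n))) (n≤1+n N)
    ... | s , s<N , e with D s in Ds | leaf s s<N
    ...   | true  | l = ⊥-elim (<⇒≱ 1≤ (≤-reflexive (trans e l)))
    ...   | false | l = subst (λ x → x < N × D x ≡ false) (sym (trans e l)) (s<N , Ds)

    root-least : ∀ {u} → 1 ≤ u → u ≤ n → D u ≡ false → better (T 1) u ≡ true
    root-least {u} _ u≤n Du =
      subst (λ x → better (T 1) x ≡ true)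
        (trans (leaf u (s≤s u≤n)) (cong (λ b → if b then 0 else u) Du))
        (root-best (N + u) ≤-refl (s≤s z≤n) (+-monoʳ-< N (s≤s u≤n)))

    all-removed : T 1 < 1 → ∀ u → 1 ≤ u → u ≤ n → D u ≡ true
    all-removed T1 u 1≤u u≤n with D u in Du
    ... | true  = refl
    ... | false = ⊥-elim (<⇒≱ T1 (proj₁ (better-le 1≤u (root-least 1≤u u≤n Du))))

  -- `remaining` counts the dummy 0 along with the elements, which costs one iteration in the bound.
  -- `ordered` is what tells the visitor that everything visited precedes the current element.
  record Extracting (r : ℕ) (m : Nats) : Set where
    field
      D         : ℕ → Bool
      ready     : Ready D m
      remaining : count N (not ∘ D) ≡ r
      ordered   : ∀ s u → D s ≡ true → 1 ≤ u → u ≤ n → D u ≡ false → le s u ≡ true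

  extract-correct : ∀ {K r m} → N ≤ 2 ^ K → Extracting r m → 1 ≤ m 2 1 →
    ∃[ r′ ] r ≡ suc r′ × Run (extractStep cmp visit) m (extractCost cmp visitCost K) (Extracting r′)
  extract-correct {K} {r} {m} N≤2^K x 1≤t =
    count N (not ∘ insert t D) , drop ,
    run-⨾ (run-≔ {x = t} refl refl
    (run-⨾ (run-mono (λ { m₁ (j , e₀ , e₂ , e₃ , e₅) →
       run-⨾ (run-≔ {i′ = N + t} {x = 0}
         (cong₂ (λ a b → suc a + b) (trans (cong (λ f → f 0) e₀) size) (cong (λ f → f 0) e₅)) refl
       (run-⨾ (run-≔ {x = h} refl (trans (cong₂ (λ a b → m₁ 3 (suc a + b))
           (trans (cong (λ f → f 0) e₀) size) (cong (λ f → f 0) e₅))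
           (trans (cong (λ f → f (N + t)) e₃) parent))
       (run-mono (λ _ y → record { D = insert t D ; ready = y ; remaining = refl ; ordered = ordered′ })
         -- Clearing the leaf puts only the match at its parent `h` out of date, and `h < N ≤ 2 ^ K`
         -- bounds the climb from there.
         (sift-loop {K = K} (record
         { shallow = ≤-trans h<N N≤2^K
         ; inner = h<N
         ; size = trans (cong (λ f → f 0) e₀) size
         ; user = stable pointerᵖ 0 h (stable treeᵖ (N + t) 0 j)
         ; halves = subst (HalvesFrom 0) (sym e₃) halves
         ; leaf = subst (λ f → Leaves (insert t D) (set f (N + t) 0)) (sym e₂) leaf′
         ; settled = subst (λ f → ∀ p → 1 ≤ p → p < N → h ≢ p → Settled (set f (N + t) 0) p)
                       (sym e₂) settled′
         })))))) })
      (visit-correct (stable currentᵖ 0 t user) refl 1≤t (s≤s⁻¹ t<N) Dt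
        (λ s Ds → ordered s t Ds 1≤t (s≤s⁻¹ t<N) Dt)))))
    where
    open Extracting x
    open Ready ready
    t h : ℕ
    t = m 2 1
    h = proj₁ (halve (N + t))
    t<N : t < N
    t<N = proj₁ (root-present ready 1≤t)
    Dt : D t ≡ false
    Dt = proj₂ (root-present ready 1≤t)
    h-halves : Halved h (N + t)
    h-halves = proj₂ (halve (N + t))
    h<N : h < N
    h<N = halved-< h-halves (+-monoʳ-< N t<N)
    parent : m 3 (N + t) ≡ h
    parent = halves z≤n (≤-trans h<N (m≤m+n N N)) h-halves
    drop : r ≡ suc (count N (not ∘ insert t D))
    drop = trans (sym remaining) (trans
      (count-update (not ∘ D) (not ∘ insert t D) t<N
        (λ s s≢t → cong not (sym (set-miss D (s≢t ∘ sym)))) (cong not (set-hit D t)))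
      (cong (λ b → bit (not b) + count N (not ∘ insert t D)) Dt))
    ordered′ : ∀ s u → insert t D s ≡ true → 1 ≤ u → u ≤ n → insert t D u ≡ false → le s u ≡ true
    ordered′ s u Ds 1≤u u≤n Du with t ≟ u
    ... | yes refl = ⊥-elim (true≢false (set-hit D t) Du)
    ... | no t≢u with Du′ ← trans (sym (set-miss D t≢u)) Du | insert⁻ t D s Ds
    -- `t` was at the root and therefore precedes everything still present.
    ...   | inj₁ refl = proj₂ (better-le 1≤u (root-least ready 1≤u u≤n Du′))
    ...   | inj₂ (_ , Ds′) = ordered s u Ds′ 1≤u u≤n Du′
    leaf′ : Leaves (insert t D) (set (m 2) (N + t) 0)
    leaf′ s s<N with t ≟ s
    ... | yes refl rewrite set-hit D t {true} = set-hit (m 2) (N + t)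
    ... | no t≢s rewrite set-miss D {x = true} t≢s =
      trans (set-miss (m 2) (t≢s ∘ +-cancelˡ-≡ N t s)) (leaf s s<N)
    settled′ : ∀ p → 1 ≤ p → p < N → h ≢ p → Settled (set (m 2) (N + t) 0) p
    settled′ p 1≤p p<N h≢p = settled-set {m 2} (<⇒≢ (≤-trans p<N (m≤m+n N t)) ∘ sym)
      (λ e → h≢p (halved-injective h-halves (subst (Halved p) (sym e) (even p))))
      (λ e → h≢p (halved-injective h-halves (subst (Halved p) (sym e) (odd p))))
      (settled p 1≤p p<N)

  tournament-correct : ∀ {K m} → N ≤ 2 ^ K → m 0 0 ≡ n → J none m →
    Run (tournament cmp visit) m (tournamentCost cmp visitCost n K) λ m′ →
      m′ 0 0 ≡ n × ∃[ D ] J D m′ × (∀ s → 1 ≤ s → s ≤ n → D s ≡ true)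
  tournament-correct {K} N≤2^K m≡n j =
    run-⨾ (run-≔ {x = N + N} refl (cong (λ k → suc k + suc k) m≡n)
    (run-⨾ (run-mono
      (λ m′ b → run-while Extracting
        (λ x g → extract-correct {K} N≤2^K x (≤ᵇ-true g))
        (λ x g → let open Extracting x in
           Ready.size ready , D , Ready.user ready , all-removed ready (≤ᵇ-false g))
        {r = N} (record { D = none ; ready = b ; remaining = count-const-true N ; ordered = λ _ _ () }))
      (run-while Building
        (λ { {zero} b g → ⊥-elim (<⇒≱ (≤ᵇ-true g) (≤-reflexive (Building.at b)))
           ; {suc i} b g → i , refl , build-correct b })
        (λ { {suc i} b g → ⊥-elim (<⇒≱ (≤ᵇ-false g) (subst (1 ≤_) (sym (Building.at b)) (s≤s z≤n)))
           ; {zero} b g → let open Building b in record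
               { size = size ; user = user ; halves = halves
               ; leaf = λ s s<N → leaf s s<N z≤n
               ; settled = λ p → settled p z≤n } })
        (record
          { at = refl ; bound = ≤-refl ; size = m≡n ; user = stable pointerᵖ 0 (N + N) j
          ; halves = λ i≤p p< _ → ⊥-elim (<⇒≱ p< i≤p)
          ; leaf = λ s s<N N+N≤ → ⊥-elim (<⇒≱ (+-monoʳ-< N s<N) N+N≤)
          ; settled = λ p N+N≤p _ p<N → ⊥-elim (<⇒≱ p<N (≤-trans (m≤m+n N N) N+N≤p)) })))))

-- Ordered reals and the lexicographic order

dec-true : ∀ {P : Set} (P? : Dec P) → does P? ≡ true → P
dec-true (yes p) _ = p

true-dec : ∀ {P : Set} (P? : Dec P) → P → does P? ≡ true
true-dec (yes _) _ = refl
true-dec (no ¬p) p = ⊥-elim (¬p p)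

-- The second conjunct encodes the implication from `d ≤ c` to `x ≤ y`, so the reals decide only
-- between equal classes.
lexᵉ : NatExp → RealExp → NatExp → RealExp → BoolExp
lexᵉ c x d y = (c ≤ⁿ d) & notᵇ ((d ≤ⁿ c) & notᵇ (x ≤ʳ y))

module Reals (ℝ : RealNumbers) where

  open RealNumbers ℝ public renaming (+-monoˡ-≤ to +ᴿ-monoˡ-≤ᴿ)
  open IsDecTotalOrder isDecTotalOrder public
    using () renaming (refl to ≤ᴿ-refl; trans to ≤ᴿ-trans; total to ≤ᴿ-total; reflexive to ≤ᴿ-reflexive)
  open CommutativeRing commutativeRing public
    using (ring; -_; -‿inverseʳ) renaming
      ( sym to ≈-sym; trans to ≈-trans; +-comm to +ᴿ-comm; +-identityˡ to +ᴿ-identityˡ)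

  0≤1 : 0# ≤ᴿ 1#
  0≤1 with ≤ᴿ-total 0# 1#
  ... | inj₁ h = h
  ... | inj₂ 1≤0 = ≤ᴿ-trans (*-nonNeg 0≤-1 0≤-1) (≤ᴿ-reflexive -1*-1≈1)
    where
    open import Algebra.Properties.Ring ring using (-1*x≈-x; -‿involutive)
    0≤-1 : 0# ≤ᴿ - 1#
    0≤-1 = ≤ᴿ-trans (≤ᴿ-reflexive (≈-sym (-‿inverseʳ 1#)))
             (≤ᴿ-trans (+ᴿ-monoˡ-≤ᴿ (- 1#) 1≤0) (≤ᴿ-reflexive (+ᴿ-identityˡ (- 1#))))
    -1*-1≈1 : (- 1# *ᴿ - 1#) ≈ 1#
    -1*-1≈1 = ≈-trans (-1*x≈-x (- 1#)) (-‿involutive 1#)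

  x≤x+1 : ∀ x → x ≤ᴿ x +ᴿ 1#
  x≤x+1 x = ≤ᴿ-trans (≤ᴿ-reflexive (≈-sym (+ᴿ-identityˡ x)))
              (≤ᴿ-trans (+ᴿ-monoˡ-≤ᴿ x 0≤1) (≤ᴿ-reflexive (+ᴿ-comm 1# x)))

  lex : ℕ → Carrier → ℕ → Carrier → Bool
  lex c x d y = (c ≤ᵇ d) ∧ not ((d ≤ᵇ c) ∧ not (does (x ≤ᴿ? y)))

  lex⁻ : ∀ {c x d y} → lex c x d y ≡ true → c < d ⊎ (c ≡ d × x ≤ᴿ y)
  lex⁻ {c} {x} {d} {y} h with c ≤ᵇ d in p | d ≤ᵇ c in q | does (x ≤ᴿ? y) in r
  ... | true | false | _    = inj₁ (≤ᵇ-false q)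
  ... | true | true  | true = inj₂ (≤-antisym (≤ᵇ-true p) (≤ᵇ-true q) , dec-true (x ≤ᴿ? y) r)

  lex-< : ∀ {c x d y} → c < d → lex c x d y ≡ true
  lex-< {c} {d = d} c<d rewrite true-≤ᵇ (<⇒≤ c<d) with d ≤ᵇ c in q
  ... | false = refl
  ... | true  = ⊥-elim (<⇒≱ c<d (≤ᵇ-true q))

  lex-≡ : ∀ {c x y} → x ≤ᴿ y → lex c x c y ≡ true
  lex-≡ {c} {x} {y} x≤y rewrite true-≤ᵇ (≤-refl {c}) | true-dec (x ≤ᴿ? y) x≤y = refl

  lex-trans : ∀ {c x d y e z} → lex c x d y ≡ true → lex d y e z ≡ true → lex c x e z ≡ true
  lex-trans {c} {x} {d} {y} {e} {z} h k with lex⁻ {c} {x} {d} {y} h | lex⁻ {d} {y} {e} {z} k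
  ... | inj₁ c<d          | inj₁ d<e          = lex-< (<-trans c<d d<e)
  ... | inj₁ c<d          | inj₂ (refl , _)   = lex-< c<d
  ... | inj₂ (refl , _)   | inj₁ d<e          = lex-< d<e
  ... | inj₂ (refl , x≤y) | inj₂ (refl , y≤z) = lex-≡ {c} (≤ᴿ-trans x≤y y≤z)

  lex-total : ∀ c x d y → lex c x d y ≡ true ⊎ lex d y c x ≡ true
  lex-total c x d y with <-cmp c d
  ... | tri< c<d _ _ = inj₁ (lex-< c<d)
  ... | tri> _ _ d<c = inj₂ (lex-< d<c)
  ... | tri≈ _ refl _ = [ inj₁ ∘ lex-≡ {c} , inj₂ ∘ lex-≡ {c} ]′ (≤ᴿ-total x y)

-- Defined by the same flip `1 ∸_` that the program applies to `classParity`.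
parityBit : ℕ → ℕ
parityBit zero    = 0
parityBit (suc k) = 1 ∸ parityBit k

parity-cases : ∀ k → parityBit k ≡ 0 ⊎ parityBit k ≡ 1
parity-cases zero = inj₁ refl
parity-cases (suc k) = [ (λ e → inj₂ (cong (1 ∸_) e)) , (λ e → inj₁ (cong (1 ∸_) e)) ]′ (parity-cases k)

parity-suc : ∀ k → parityBit (suc k) ≢ parityBit k
parity-suc k e with parityBit k | parity-cases k
parity-suc k () | .0 | inj₁ refl
parity-suc k () | .1 | inj₂ refl

-- Classification by bottom edges

-- Natural arrays: 6 the class of an element, 7 its parity, 8 the lowest element of
-- the class being filled, 9 and 10 the number of that class and its parity.

leftᵉ rightᵉ bottomᵉ : NatExp → RealExp
leftᵉ e   = real[ 0 ][ e ⊖ lit 1 ]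
rightᵉ e  = real[ 1 ][ e ⊖ lit 1 ]
bottomᵉ e = real[ 2 ][ e ⊖ lit 1 ]

classOf parityOf : NatExp → NatExp
classOf  = nat[ 6 ][_]
parityOf = nat[ 7 ][_]

base class classParity : NatExp
base        = nat[ 8 ][ lit 0 ]
class       = nat[ 9 ][ lit 0 ]
classParity = nat[ 10 ][ lit 0 ]

byBottom : NatExp → NatExp → BoolExp
byBottom a b = bottomᵉ a ≤ʳ bottomᵉ b

-- Base 0 means that no class is open, so the first element visited always opens one and the classes
-- are numbered from 1.
classify : Program
classify =
  (ifᵖ (lit 1 ≤ⁿ base) & (bottomᵉ current ≤ʳ bottomᵉ base ⊞ oneᴿ)
   then skip
   else (nat[ 8 ][ lit 0 ]≔ current ⨾
         nat[ 9 ][ lit 0 ]≔ lit 1 ⊕ class ⨾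
         nat[ 10 ][ lit 0 ]≔ lit 1 ⊖ classParity)) ⨾
  nat[ 6 ][ current ]≔ class ⨾
  nat[ 7 ][ current ]≔ classParity

module Classification
  (ℝ : RealNumbers) (ρ : ℕ → ℕ → RealNumbers.Carrier ℝ) where

  open Machine ℝ ρ
  open Reals ℝ

  bottomOf : ℕ → Carrier
  bottomOf s = ρ 2 (s ∸ 1)

  private
    B : ℕ → Carrier
    B = bottomOf

  -- `near` and `apart` are what the second scan uses: vertical overlap within a class, disjointness
  -- at class distance at least 2. Neighbouring classes may well overlap. Behind `far` is that the
  -- base of class `k` exceeds the preceding base by more than 1, while all classes before the
  -- preceding one lie at or below that preceding base.
  record Classes (D : ℕ → Bool) (cls par : ℕ → ℕ) (β k π : ℕ) : Set where
    field
      parity-now : π ≡ parityBit k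
      parity-of  : ∀ {s} → D s ≡ true → par s ≡ parityBit (cls s)
      base-set   : ∀ {s} → D s ≡ true → 1 ≤ β
      base-done  : 1 ≤ β → D β ≡ true
      class≤     : ∀ {s} → D s ≡ true → cls s ≤ k
      below      : ∀ {s} → D s ≡ true → B s ≤ᴿ B β +ᴿ 1#
      above      : ∀ {s} → D s ≡ true → cls s ≡ k → B β ≤ᴿ B s
      earlier    : ∀ {s} → D s ≡ true → cls s < k → B s ≤ᴿ B β
      far        : ∀ {s} → D s ≡ true → 2 + cls s ≤ k → ¬ B β ≤ᴿ B s +ᴿ 1#
      near       : ∀ {s u} → D s ≡ true → D u ≡ true → cls s ≡ cls u → B s ≤ᴿ B u +ᴿ 1#
      apart      : ∀ {s u} → D s ≡ true → D u ≡ true → 2 + cls s ≤ cls u → ¬ B u ≤ᴿ B s +ᴿ 1#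

  module _ {D cls par β k π t} (cs : Classes D cls par β k π)
           (least : ∀ s → D s ≡ true → B s ≤ᴿ B t) where
    open Classes cs

    private
      shift : ∀ {x y} → x ≤ᴿ y → x +ᴿ 1# ≤ᴿ y +ᴿ 1#
      shift = +ᴿ-monoˡ-≤ᴿ 1#

    join-class : 1 ≤ β → B t ≤ᴿ B β +ᴿ 1# →
                 Classes (insert t D) (set cls t k) (set par t π) β k π
    join-class 1≤β t≤ = record
      { parity-now = parity-now
      ; parity-of  = parity-of′
      ; base-set   = λ _ → 1≤β
      ; base-done  = λ _ → β-done
      ; class≤     = class≤′
      ; below      = below′
      ; above      = above′
      ; earlier    = earlier′
      ; far        = far′
      ; near       = near′
      ; apart      = apart′
      }
      where
      D′ = insert t D
      c′ = set cls t k
      β≤t : B β ≤ᴿ B t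
      β≤t = least β (base-done 1≤β)
      β-done : D′ β ≡ true
      β-done with t ≟ β
      ... | yes refl = set-hit D t
      ... | no t≢β   = trans (set-miss D t≢β) (base-done 1≤β)
      parity-of′ : ∀ {s} → D′ s ≡ true → set par t π s ≡ parityBit (c′ s)
      parity-of′ {s} Ds with insert⁻ t D s Ds
      ... | inj₁ refl rewrite set-hit par t {π} | set-hit cls t {k} = parity-now
      ... | inj₂ (s≢t , Ds) rewrite set-miss par {x = π} (s≢t ∘ sym) | set-miss cls {x = k} (s≢t ∘ sym) = parity-of Ds
      class≤′ : ∀ {s} → D′ s ≡ true → c′ s ≤ k
      class≤′ {s} Ds with insert⁻ t D s Ds
      ... | inj₁ refl rewrite set-hit cls t {k} = ≤-refl
      ... | inj₂ (s≢t , Ds) rewrite set-miss cls {x = k} (s≢t ∘ sym) = class≤ Ds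
      below′ : ∀ {s} → D′ s ≡ true → B s ≤ᴿ B β +ᴿ 1#
      below′ {s} Ds with insert⁻ t D s Ds
      ... | inj₁ refl = t≤
      ... | inj₂ (s≢t , Ds) = below Ds
      above′ : ∀ {s} → D′ s ≡ true → c′ s ≡ k → B β ≤ᴿ B s
      above′ {s} Ds with insert⁻ t D s Ds
      ... | inj₁ refl = λ _ → β≤t
      ... | inj₂ (s≢t , Ds) rewrite set-miss cls {x = k} (s≢t ∘ sym) = above Ds
      earlier′ : ∀ {s} → D′ s ≡ true → c′ s < k → B s ≤ᴿ B β
      earlier′ {s} Ds with insert⁻ t D s Ds
      ... | inj₁ refl rewrite set-hit cls t {k} = λ k<k → ⊥-elim (<-irrefl refl k<k)
      ... | inj₂ (s≢t , Ds) rewrite set-miss cls {x = k} (s≢t ∘ sym) = earlier Ds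
      far′ : ∀ {s} → D′ s ≡ true → 2 + c′ s ≤ k → ¬ B β ≤ᴿ B s +ᴿ 1#
      far′ {s} Ds with insert⁻ t D s Ds
      ... | inj₁ refl rewrite set-hit cls t {k} = λ k+2≤k → ⊥-elim (<⇒≱ k+2≤k (n≤1+n k))
      ... | inj₂ (s≢t , Ds) rewrite set-miss cls {x = k} (s≢t ∘ sym) = far Ds
      near′ : ∀ {s u} → D′ s ≡ true → D′ u ≡ true → c′ s ≡ c′ u → B s ≤ᴿ B u +ᴿ 1#
      near′ {s} {u} Ds Du with insert⁻ t D s Ds | insert⁻ t D u Du
      ... | inj₁ refl | inj₁ refl = λ _ → x≤x+1 (B t)
      ... | inj₁ refl | inj₂ (u≢t , Du) rewrite set-hit cls t {k} | set-miss cls {x = k} (u≢t ∘ sym) =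
        -- `u` is in the current class, hence at or above the base, and `t` is at most 1 above the
        -- base.
        λ e → ≤ᴿ-trans t≤ (shift (above Du (sym e)))
      ... | inj₂ (s≢t , Ds) | inj₁ refl = λ _ → ≤ᴿ-trans (least s Ds) (x≤x+1 (B t))
      ... | inj₂ (s≢t , Ds) | inj₂ (u≢t , Du)
        rewrite set-miss cls {x = k} (u≢t ∘ sym) | set-miss cls {x = k} (s≢t ∘ sym) = near Ds Du
      apart′ : ∀ {s u} → D′ s ≡ true → D′ u ≡ true → 2 + c′ s ≤ c′ u → ¬ B u ≤ᴿ B s +ᴿ 1#
      apart′ {s} {u} Ds Du with insert⁻ t D s Ds | insert⁻ t D u Du
      ... | inj₁ refl | _ = λ le → ⊥-elim (<⇒≱ (≤-trans (n≤1+n _) (subst (λ x → 2 + x ≤ c′ u) (set-hit cls t) le)) (class≤′ Du))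
      ... | inj₂ (s≢t , Ds) | inj₁ refl rewrite set-hit cls t {k} | set-miss cls {x = k} (s≢t ∘ sym) =
        -- `t` lies at or above the base, which is already more than 1 above `s`.
        λ le t≤s+1 → far Ds le (≤ᴿ-trans β≤t t≤s+1)
      ... | inj₂ (s≢t , Ds) | inj₂ (u≢t , Du)
        rewrite set-miss cls {x = k} (u≢t ∘ sym) | set-miss cls {x = k} (s≢t ∘ sym) = apart Ds Du

    open-class : (1 ≤ β → ¬ B t ≤ᴿ B β +ᴿ 1#) → 1 ≤ t →
                 Classes (insert t D) (set cls t (suc k)) (set par t (1 ∸ π)) t (suc k) (1 ∸ π)
    open-class t≰ 1≤t = record
      { parity-now = cong (1 ∸_) parity-now
      ; parity-of  = parity-of′
      ; base-set   = λ _ → 1≤t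
      ; base-done  = λ _ → set-hit D t
      ; class≤     = class≤′
      ; below      = λ Ds → ≤ᴿ-trans (least′ Ds) (x≤x+1 (B t))
      ; above      = above′
      ; earlier    = λ Ds _ → least′ Ds
      ; far        = far′
      ; near       = near′
      ; apart      = apart′
      }
      where
      D′ = insert t D
      c′ = set cls t (suc k)
      least′ : ∀ {s} → D′ s ≡ true → B s ≤ᴿ B t
      least′ {s} Ds with insert⁻ t D s Ds
      ... | inj₁ refl = ≤ᴿ-refl
      ... | inj₂ (_ , Ds) = least s Ds
      parity-of′ : ∀ {s} → D′ s ≡ true → set par t (1 ∸ π) s ≡ parityBit (c′ s)
      parity-of′ {s} Ds with insert⁻ t D s Ds
      ... | inj₁ refl rewrite set-hit par t {1 ∸ π} | set-hit cls t {suc k} = cong (1 ∸_) parity-now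
      ... | inj₂ (s≢t , Ds) rewrite set-miss par {x = 1 ∸ π} (s≢t ∘ sym) | set-miss cls {x = suc k} (s≢t ∘ sym) = parity-of Ds
      class≤′ : ∀ {s} → D′ s ≡ true → c′ s ≤ suc k
      class≤′ {s} Ds with insert⁻ t D s Ds
      ... | inj₁ refl rewrite set-hit cls t {suc k} = ≤-refl
      ... | inj₂ (s≢t , Ds) rewrite set-miss cls {x = suc k} (s≢t ∘ sym) = m≤n⇒m≤1+n (class≤ Ds)
      above′ : ∀ {s} → D′ s ≡ true → c′ s ≡ suc k → B t ≤ᴿ B s
      above′ {s} Ds with insert⁻ t D s Ds
      ... | inj₁ refl = λ _ → ≤ᴿ-refl
      ... | inj₂ (s≢t , Ds) rewrite set-miss cls {x = suc k} (s≢t ∘ sym) = λ e → ⊥-elim (<⇒≢ (s≤s (class≤ Ds)) e)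
      far′ : ∀ {s} → D′ s ≡ true → 2 + c′ s ≤ suc k → ¬ B t ≤ᴿ B s +ᴿ 1#
      far′ {s} Ds with insert⁻ t D s Ds
      ... | inj₁ refl rewrite set-hit cls t {suc k} = λ h → ⊥-elim (<⇒≱ h (n≤1+n _))
      ... | inj₂ (s≢t , Ds) rewrite set-miss cls {x = suc k} (s≢t ∘ sym) =
        -- `s` precedes the class `k` just closed, so it lies at or below the old base, which `t`
        -- exceeds by more than 1.
        λ h t≤ → t≰ (base-set Ds) (≤ᴿ-trans t≤ (shift (earlier Ds (s≤s⁻¹ h))))
      near′ : ∀ {s u} → D′ s ≡ true → D′ u ≡ true → c′ s ≡ c′ u → B s ≤ᴿ B u +ᴿ 1#
      near′ {s} {u} Ds Du with insert⁻ t D s Ds | insert⁻ t D u Du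
      ... | inj₁ refl | inj₁ refl = λ _ → x≤x+1 (B t)
      ... | inj₁ refl | inj₂ (u≢t , Du) rewrite set-hit cls t {suc k} | set-miss cls {x = suc k} (u≢t ∘ sym) =
        λ e → ⊥-elim (<⇒≢ (s≤s (class≤ Du)) (sym e))
      ... | inj₂ (s≢t , Ds) | inj₁ refl = λ _ → ≤ᴿ-trans (least s Ds) (x≤x+1 (B t))
      ... | inj₂ (s≢t , Ds) | inj₂ (u≢t , Du)
        rewrite set-miss cls {x = suc k} (u≢t ∘ sym) | set-miss cls {x = suc k} (s≢t ∘ sym) = near Ds Du
      apart′ : ∀ {s u} → D′ s ≡ true → D′ u ≡ true → 2 + c′ s ≤ c′ u → ¬ B u ≤ᴿ B s +ᴿ 1#
      apart′ {s} {u} Ds Du with insert⁻ t D s Ds | insert⁻ t D u Du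
      ... | inj₁ refl | _ = λ le → ⊥-elim (<⇒≱ (≤-trans (n≤1+n _) (subst (λ x → 2 + x ≤ c′ u) (set-hit cls t) le)) (class≤′ Du))
      ... | inj₂ (s≢t , Ds′) | inj₁ refl = λ le → far′ Ds (subst (2 + c′ s ≤_) (set-hit cls t) le)
      ... | inj₂ (s≢t , Ds) | inj₂ (u≢t , Du)
        rewrite set-miss cls {x = suc k} (u≢t ∘ sym) | set-miss cls {x = suc k} (s≢t ∘ sym) = apart Ds Du

  Classified : (ℕ → Bool) → Nats → Set
  Classified D m = Classes D (m 6) (m 7) (m 8 0) (m 9 0) (m 10 0)

  classify-correct : ∀ {D m t} → Classified D m → m 5 0 ≡ t → 1 ≤ t →
    (∀ s → D s ≡ true → does (B s ≤ᴿ? B t) ≡ true) →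
    Run classify m (flatCost classify) λ m′ →
      Classified (insert t D) m′ × m′ 0 ≡ m 0 × m′ 2 ≡ m 2 × m′ 3 ≡ m 3 × m′ 5 ≡ m 5
  classify-correct {D} {m} {t} cs refl 1≤t least =
    run-⨾ (run-if refl
      (λ h → let 1≤β , t≤ = split h in
        run-skip (run-⨾ (run-≔ refl refl (run-≔ refl refl
          (join-class {D} {m 6} {m 7} {m 8 0} {m 9 0} {m 10 0} {m 5 0} cs least′ 1≤β t≤ , refl , refl , refl , refl)))))
      (λ h → run-⨾ (run-≔ refl refl (run-⨾ (run-≔ refl refl (run-≔ refl refl
        (run-⨾ (run-≔ refl refl (run-≔ refl refl
          (open-class {D} {m 6} {m 7} {m 8 0} {m 9 0} {m 10 0} {m 5 0} cs least′ (split′ h) 1≤t , refl , refl , refl , refl))))))))))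
    where
    least′ : ∀ s → D s ≡ true → B s ≤ᴿ B t
    least′ s Ds = dec-true (B s ≤ᴿ? B t) (least s Ds)
    split : ((1 ≤ᵇ m 8 0) ∧ does (B t ≤ᴿ? (B (m 8 0) +ᴿ 1#))) ≡ true →
            1 ≤ m 8 0 × B t ≤ᴿ B (m 8 0) +ᴿ 1#
    split h with 1 ≤ᵇ m 8 0 in p | does (B t ≤ᴿ? (B (m 8 0) +ᴿ 1#)) in q
    ... | true | true = ≤ᵇ-true p , dec-true (B t ≤ᴿ? (B (m 8 0) +ᴿ 1#)) q
    split′ : ((1 ≤ᵇ m 8 0) ∧ does (B t ≤ᴿ? (B (m 8 0) +ᴿ 1#))) ≡ false →
             1 ≤ m 8 0 → ¬ B t ≤ᴿ B (m 8 0) +ᴿ 1#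
    split′ h 1≤β t≤
      rewrite true-≤ᵇ 1≤β | true-dec (B t ≤ᴿ? (B (m 8 0) +ᴿ 1#)) t≤ with () ← h

-- Optimality of the two-track greedy

count-insert : ∀ {n t} D {P P′ : ℕ → Bool} → t < n → D t ≡ false → (∀ s → t ≢ s → P′ s ≡ P s) →
               count n (λ s → insert t D s ∧ P′ s) ≡ bit (P′ t) + count n (λ s → D s ∧ P s)
count-insert {n} {t} D {P} {P′} t<n Dt P′≗P =
  trans (count-update _ _ t<n off (cong (_∧ P t) Dt))
        (cong (λ b → bit b + count n (λ s → D s ∧ P s)) (cong (_∧ P′ t) (set-hit D t)))
  where
  off : ∀ s → s ≢ t → (insert t D s ∧ P′ s) ≡ (D s ∧ P s)
  off s s≢t = cong₂ _∧_ (set-miss D (s≢t ∘ sym)) (P′≗P s (s≢t ∘ sym))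

place : (Bool → ℕ) → Bool → ℕ → Bool → ℕ
place f true  t true  = t
place f true  t false = f false
place f false t true  = f true
place f false t false = t

place-hit : ∀ f κ t → place f κ t κ ≡ t
place-hit f true  t = refl
place-hit f false t = refl

place-not : ∀ f κ t → place f κ t (not κ) ≡ f (not κ)
place-not f true  t = refl
place-not f false t = refl

place-cases : ∀ f κ t (λ′ : Bool) → (λ′ ≡ κ × place f κ t λ′ ≡ t) ⊎ place f κ t λ′ ≡ f λ′
place-cases f true  t true  = inj₁ (refl , refl)
place-cases f true  t false = inj₂ refl
place-cases f false t true  = inj₂ refl
place-cases f false t false = inj₁ (refl , refl)

-- Greedy two-colouring of an interval order.  blocks e t says that the interval t,
-- visited after e, cannot share a colour with e; 0 is the end of an empty track.

module Greedy (n : ℕ) (le blocks : ℕ → ℕ → Bool) (blocks-zero : ∀ u → blocks 0 u ≡ false) where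

  infix 4 _⊑_

  -- Track ends are compared by what they block instead of by coordinates; smaller is more
  -- favourable. The empty track is then a least element without any real number standing for minus
  -- infinity.
  _⊑_ : ℕ → ℕ → Set
  e ⊑ f = ∀ u → blocks e u ≡ true → blocks f u ≡ true

  ⊑-refl : ∀ {e} → e ⊑ e
  ⊑-refl u h = h

  ⊑-trans : ∀ {e f g} → e ⊑ f → f ⊑ g → e ⊑ g
  ⊑-trans p q u h = q u (p u h)

  0⊑ : ∀ {e} → 0 ⊑ e
  0⊑ u h = ⊥-elim (true≢false h (blocks-zero u))

  ⊑-free : ∀ {e f u} → e ⊑ f → blocks f u ≡ false → blocks e u ≡ false
  ⊑-free {e} {f} {u} p h with blocks e u in eq
  ... | false = refl
  ... | true  = ⊥-elim (true≢false (p u eq) h)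

  -- Step e₁ e₂ t e₁′ e₂′ x k: k is 1 if t is accepted, and x > 0 is the mark it then receives.
  data Step (e₁ e₂ t : ℕ) : ℕ → ℕ → ℕ → ℕ → Set where
    reject : blocks e₁ t ≡ true → blocks e₂ t ≡ true → Step e₁ e₂ t e₁ e₂ 0 0
    first  : ∀ {x} → blocks e₁ t ≡ false → Step e₁ e₂ t t e₂ (suc x) 1
    second : ∀ {x} → blocks e₁ t ≡ true → blocks e₂ t ≡ false → Step e₁ e₂ t t e₁ (suc x) 1

  -- Greedy with c accepted intervals and tracks ending in e₁, e₂ against a rival with d
  -- accepted intervals and tracks ending in f: a lead of i makes up for i worse ends.
  data Ahead (c d e₁ e₂ : ℕ) (f : Bool → ℕ) : Set where
    level : ∀ κ → d ≤ c → e₁ ⊑ f κ → e₂ ⊑ f (not κ) → Ahead c d e₁ e₂ f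
    oneUp : ∀ κ → 1 + d ≤ c → e₂ ⊑ f κ → Ahead c d e₁ e₂ f
    twoUp : 2 + d ≤ c → Ahead c d e₁ e₂ f

  ahead⇒≤ : ∀ {c d e₁ e₂ f} → Ahead c d e₁ e₂ f → d ≤ c
  ahead⇒≤ (level _ h _ _) = h
  ahead⇒≤ (oneUp _ h _)   = ≤-trans (n≤1+n _) h
  ahead⇒≤ (twoUp h)       = ≤-trans (≤-trans (n≤1+n _) (n≤1+n _)) h

  module _ {e₁ e₂ t e₁′ e₂′ x k : ℕ} (e₂⊑e₁ : e₂ ⊑ e₁) (step : Step e₁ e₂ t e₁′ e₂′ x k) where

    -- Accepting costs the greedy at most one favourable end and gains one in the lead. The
    -- comparison that survives is that of the end left in place: `e₂` after `first`, and `e₁`, now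
    -- the second end, after `second`.
    rival-skips : ∀ {c d f} → Ahead c d e₁ e₂ f → Ahead (k + c) d e₁′ e₂′ f
    rival-skips = go step
      where
      go : ∀ {e₁′ e₂′ x k c d f} → Step e₁ e₂ t e₁′ e₂′ x k → Ahead c d e₁ e₂ f → Ahead (k + c) d e₁′ e₂′ f
      go (reject _ _) a               = a
      go (first _)  (level κ h p q) = oneUp (not κ) (s≤s h) q
      go (first _)  (oneUp _ h _)   = twoUp (s≤s h)
      go (first _)  (twoUp h)       = twoUp (m≤n⇒m≤1+n h)
      go (second _ _) (level κ h p q) = oneUp κ (s≤s h) p
      go (second _ _) (oneUp _ h _)   = twoUp (s≤s h)
      go (second _ _) (twoUp h)       = twoUp (m≤n⇒m≤1+n h)

    module _ (e₁⊑t : e₁ ⊑ t) (e₂⊑t : e₂ ⊑ t) where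

      -- If the greedy rejects `t`, every rival track matched with one of its ends is blocked too.
      -- At equal counts the rival could not take `t`; with a lead, one unit is spent, and the
      -- rival's new end `t`, which blocks at least as much as either end of the greedy, restores
      -- one comparison. If both accept, the new ends can be matched with each other.
      rival-takes : ∀ {c d f} → (λ′ : Bool) → blocks (f λ′) t ≡ false →
                    Ahead c d e₁ e₂ f → Ahead (k + c) (1 + d) e₁′ e₂′ (place f λ′ t)
      rival-takes λ′ free a = go step λ′ free a
        where
        stuck : ∀ {e f} {A : Set} → blocks e t ≡ true → e ⊑ f → blocks f t ≡ false → A
        stuck b p free = ⊥-elim (true≢false (p t b) free)

        to-hit : ∀ {e f} κ → e ⊑ t → e ⊑ place f κ t κ
        to-hit {f = f} κ p = subst (_ ⊑_) (sym (place-hit f κ t)) p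

        go : ∀ {e₁′ e₂′ x k c d f} → Step e₁ e₂ t e₁′ e₂′ x k → (λ′ : Bool) → blocks (f λ′) t ≡ false →
             Ahead c d e₁ e₂ f → Ahead (k + c) (1 + d) e₁′ e₂′ (place f λ′ t)
        go (reject b₁ b₂) true  free (level true  h p q) = stuck b₁ p free
        go (reject b₁ b₂) true  free (level false h p q) = stuck b₂ q free
        go (reject b₁ b₂) false free (level true  h p q) = stuck b₂ q free
        go (reject b₁ b₂) false free (level false h p q) = stuck b₁ p free
        go (reject b₁ b₂) true  free (oneUp true  h q) = stuck b₂ q free
        go (reject b₁ b₂) true  free (oneUp false h q) = level true h e₁⊑t q
        go (reject b₁ b₂) false free (oneUp true  h q) = level false h e₁⊑t q
        go (reject b₁ b₂) false free (oneUp false h q) = stuck b₂ q free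
        go (reject b₁ b₂) λ′ free (twoUp h) = oneUp λ′ h (to-hit λ′ e₂⊑t)
        go (first b) true  free (level true  h p q) = level true (s≤s h) ⊑-refl q
        -- The rival overwrote the end matched with `e₂` and kept the one matched with `e₁`. Having
        -- overwritten the later end, the greedy still holds `e₂`, and `e₂ ⊑ e₁` matches it with the
        -- kept end.
        go (first b) true  free (level false h p q) = level true (s≤s h) ⊑-refl (⊑-trans e₂⊑e₁ p)
        go (first b) false free (level true  h p q) = level false (s≤s h) ⊑-refl (⊑-trans e₂⊑e₁ p)
        go (first b) false free (level false h p q) = level false (s≤s h) ⊑-refl q
        go (first b) λ′ free (oneUp κ h q) = oneUp λ′ (s≤s h) (to-hit λ′ e₂⊑t)
        go (first b) λ′ free (twoUp h) = twoUp (s≤s h)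
        go (second b _) true  free (level true  h p q) = stuck b p free
        go (second b _) true  free (level false h p q) = level true (s≤s h) ⊑-refl p
        go (second b _) false free (level true  h p q) = level false (s≤s h) ⊑-refl p
        go (second b _) false free (level false h p q) = stuck b p free
        go (second b _) λ′ free (oneUp κ h q) = oneUp λ′ (s≤s h) (to-hit λ′ e₁⊑t)
        go (second b _) λ′ free (twoUp h) = twoUp (s≤s h)

  -- Only conflicts seen by `blocks` are forbidden, so members of different classes may intersect
  -- freely; this is the relaxation under which an optimal subset becomes a rival.
  record Solution : Set where
    field
      member side : ℕ → Bool
      compatible  : ∀ {s t} → 1 ≤ s → s ≤ n → 1 ≤ t → t ≤ n → s ≢ t →
                    member s ≡ true → member t ≡ true → side s ≡ side t →
                    le s t ≡ true → blocks s t ≡ false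

  -- The rival is `O` restricted to the visited set. A nonzero `f κ` is just some visited member of
  -- colour `κ`: `compatible` already ensures that it does not block the next member of that colour.
  Compared : Solution → (ℕ → Bool) → ℕ → ℕ → ℕ → Set
  Compared O D c e₁ e₂ = ∃[ f ]
      (∀ κ → f κ ≡ 0 ⊎ (D (f κ) ≡ true × member (f κ) ≡ true × side (f κ) ≡ κ))
    × Ahead c (count (suc n) (λ s → D s ∧ member s)) e₁ e₂ f
    where open Solution O

  Chosen : (ℕ → Bool) → (ℕ → ℕ) → ℕ → Set
  Chosen D sel s = D s ≡ true × 1 ≤ sel s

  -- The ends `e₁` and `e₂` are ordered by lateness, so they change colours when `second` applies;
  -- `latest` records the colour of `e₁`. By `under`, testing a new element against the end of a
  -- track tests it against the whole track.
  record Coloured (D : ℕ → Bool) (sel : ℕ → ℕ) (e₁ e₂ : ℕ) : Set where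
    field
      colour : ℕ → Bool
      ends   : Bool → ℕ
      latest : Bool
      ends₁  : ends latest ≡ e₁
      ends₂  : ends (not latest) ≡ e₂
      under  : ∀ {s} → Chosen D sel s → s ⊑ ends (colour s)
      free   : ∀ {s u} → Chosen D sel s → Chosen D sel u → s ≢ u → colour s ≡ colour u →
               blocks s u ≡ false ⊎ blocks u s ≡ false

  record Invariant (D : ℕ → Bool) (sel : ℕ → ℕ) (c e₁ e₂ : ℕ) : Set where
    field
      elements : ∀ {s} → D s ≡ true → 1 ≤ s × s ≤ n
      done₁    : e₁ ≡ 0 ⊎ D e₁ ≡ true
      done₂    : e₂ ≡ 0 ⊎ D e₂ ≡ true
      e₂⊑e₁    : e₂ ⊑ e₁
      coloured : Coloured D sel e₁ e₂
      compared : ∀ O → Compared O D c e₁ e₂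

  start : ∀ {sel} → Invariant (λ _ → false) sel 0 0 0
  start = record
    { elements = λ () ; done₁ = inj₁ refl ; done₂ = inj₁ refl ; e₂⊑e₁ = ⊑-refl
    ; coloured = record
        { colour = λ _ → true ; ends = λ _ → 0 ; latest = true ; ends₁ = refl ; ends₂ = refl
        ; under = λ () ; free = λ () }
    ; compared = λ O → (λ _ → 0) , (λ _ → inj₁ refl) ,
        level true (≤-reflexive (count-const-false (suc n))) ⊑-refl ⊑-refl }

  module _ {D sel c e₁ e₂ t e₁′ e₂′ x k} (inv : Invariant D sel c e₁ e₂)
    (1≤t : 1 ≤ t) (t≤n : t ≤ n) (Dt : D t ≡ false)
    (le-t : ∀ {s} → D s ≡ true → le s t ≡ true) (⊑t : ∀ {s} → D s ≡ true → s ⊑ t)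
    (step : Step e₁ e₂ t e₁′ e₂′ x k) where

    open Invariant inv
    open Coloured coloured

    private
      D′ : ℕ → Bool
      D′ = insert t D

      sel′ : ℕ → ℕ
      sel′ = set sel t x

    D⇒≢t : ∀ {s} → D s ≡ true → t ≢ s
    D⇒≢t Ds refl = true≢false Ds Dt

    insert-old : ∀ {s} → D s ≡ true → D′ s ≡ true
    insert-old Ds = trans (set-miss D (D⇒≢t Ds)) Ds

    end⊑t : ∀ {e} → e ≡ 0 ⊎ D e ≡ true → e ⊑ t
    end⊑t (inj₁ refl) = 0⊑
    end⊑t (inj₂ De)   = ⊑t De

    end-old : ∀ {e} → e ≡ 0 ⊎ D e ≡ true → e ≡ 0 ⊎ D′ e ≡ true
    end-old (inj₁ e≡0) = inj₁ e≡0
    end-old (inj₂ De)  = inj₂ (insert-old De)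

    chosen⁻ : ∀ {s} → Chosen D′ sel′ s → (s ≡ t × 1 ≤ x) ⊎ (t ≢ s × Chosen D sel s)
    chosen⁻ {s} (Ds , 1≤) with insert⁻ t D s Ds
    ... | inj₁ refl = inj₁ (refl , subst (1 ≤_) (set-hit sel t) 1≤)
    ... | inj₂ (s≢t , Ds′) = inj₂ (s≢t ∘ sym , Ds′ , subst (1 ≤_) (set-miss sel (s≢t ∘ sym)) 1≤)

    module _ (κ : Bool) where

      free-end : blocks (ends κ) t ≡ false →
                 let colour′ = set colour t κ in
                 ∀ {s u} → Chosen D′ sel′ s → Chosen D′ sel′ u → s ≢ u → colour′ s ≡ colour′ u →
                 blocks s u ≡ false ⊎ blocks u s ≡ false
      free-end fr {s} {u} cs cu s≢u e with chosen⁻ cs | chosen⁻ cu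
      ... | inj₁ (refl , _) | inj₁ (refl , _) = ⊥-elim (s≢u refl)
      ... | inj₁ (refl , _) | inj₂ (t≢u , cu′)
        rewrite set-hit colour t {κ} | set-miss colour {x = κ} t≢u | e = inj₂ (⊑-free (under cu′) fr)
      ... | inj₂ (t≢s , cs′) | inj₁ (refl , _)
        rewrite set-hit colour t {κ} | set-miss colour {x = κ} t≢s | sym e = inj₁ (⊑-free (under cs′) fr)
      ... | inj₂ (t≢s , cs′) | inj₂ (t≢u , cu′)
        rewrite set-miss colour {x = κ} t≢s | set-miss colour {x = κ} t≢u = free cs′ cu′ s≢u e

      under-end : ∀ {s} → Chosen D′ sel′ s → s ⊑ place ends κ t (set colour t κ s)
      under-end {s} cs with chosen⁻ cs
      ... | inj₁ (refl , _) rewrite set-hit colour t {κ} | place-hit ends κ t = ⊑-refl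
      ... | inj₂ (t≢s , cs′) rewrite set-miss colour {x = κ} t≢s with place-cases ends κ t (colour s)
      ...   | inj₁ (_ , e) = subst (s ⊑_) (sym e) (⊑t (proj₁ cs′))
      ...   | inj₂ e = subst (s ⊑_) (sym e) (under cs′)

    coloured′ : Coloured D′ sel′ e₁′ e₂′
    coloured′ = go step refl
      where
      go : ∀ {f₁ f₂ y j} → Step e₁ e₂ t f₁ f₂ y j → y ≡ x → Coloured D′ sel′ f₁ f₂
      go (reject _ _) refl = record
        { colour = colour ; ends = ends ; latest = latest ; ends₁ = ends₁ ; ends₂ = ends₂
        ; under = λ cs → under (old cs)
        ; free = λ cs cu → free (old cs) (old cu) }
        where
        old : ∀ {s} → Chosen D′ sel′ s → Chosen D sel s
        -- A rejected `t` gets the mark 0 and so is not among the chosen elements.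
        old cs with chosen⁻ cs
        ... | inj₂ (_ , cs′) = cs′
      go (first fr) refl = record
        { colour = set colour t latest ; ends = place ends latest t ; latest = latest
        ; ends₁ = place-hit ends latest t
        ; ends₂ = trans (place-not ends latest t) ends₂
        ; under = under-end latest
        ; free = free-end latest (subst (λ e → blocks e t ≡ false) (sym ends₁) fr) }
      go (second _ fr) refl = record
        { colour = set colour t (not latest) ; ends = place ends (not latest) t ; latest = not latest
        ; ends₁ = place-hit ends (not latest) t
        ; ends₂ = trans (place-not ends (not latest) t) (trans (cong ends (not-involutive latest)) ends₁)
        ; under = under-end (not latest)
        ; free = free-end (not latest) (subst (λ e → blocks e t ≡ false) (sym ends₂) fr) }

    compared′ : ∀ O → Compared O D′ (k + c) e₁′ e₂′
    compared′ O with compared O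
    ... | f , f-done , a with Solution.member O t in member-t
    ...   | false = f , old , subst (λ d → Ahead (k + c) d e₁′ e₂′ f) (sym tally) (rival-skips e₂⊑e₁ step a)
      where
      open Solution O
      old : ∀ κ → f κ ≡ 0 ⊎ (D′ (f κ) ≡ true × member (f κ) ≡ true × side (f κ) ≡ κ)
      old κ with f-done κ
      ... | inj₁ z = inj₁ z
      ... | inj₂ (d , m) = inj₂ (insert-old d , m)
      tally : count (suc n) (λ s → D′ s ∧ member s) ≡ count (suc n) (λ s → D s ∧ member s)
      tally = trans (count-insert D {member} (s≤s t≤n) Dt (λ _ _ → refl))
                (cong (λ b → bit b + count (suc n) (λ s → D s ∧ member s)) member-t)
    ...   | true = place f (side t) t , new ,
                   subst (λ d → Ahead (k + c) d e₁′ e₂′ (place f (side t) t)) (sym tally)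
                     (rival-takes e₂⊑e₁ step (end⊑t done₁) (end⊑t done₂) (side t) fits a)
      where
      open Solution O
      fits : blocks (f (side t)) t ≡ false
      fits with f-done (side t)
      ... | inj₁ z rewrite z = blocks-zero t
      ... | inj₂ (d , m , sd) with 1≤f , f≤n ← elements d =
        compatible 1≤f f≤n 1≤t t≤n (D⇒≢t d ∘ sym) m member-t sd (le-t d)
      new : ∀ κ → place f (side t) t κ ≡ 0 ⊎
            (D′ (place f (side t) t κ) ≡ true × member (place f (side t) t κ) ≡ true × side (place f (side t) t κ) ≡ κ)
      new κ with place-cases f (side t) t κ
      ... | inj₁ (refl , e) rewrite e = inj₂ (set-hit D t , member-t , refl)
      ... | inj₂ e rewrite e with f-done κ
      ...   | inj₁ z = inj₁ z
      ...   | inj₂ (d , m) = inj₂ (insert-old d , m)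
      tally : count (suc n) (λ s → D′ s ∧ member s) ≡ 1 + count (suc n) (λ s → D s ∧ member s)
      tally = trans (count-insert D {member} (s≤s t≤n) Dt (λ _ _ → refl))
                (cong (λ b → bit b + count (suc n) (λ s → D s ∧ member s)) member-t)

    invariant-step : Invariant D′ sel′ (k + c) e₁′ e₂′
    invariant-step = record
      { elements = elements′
      ; done₁ = done₁′ step ; done₂ = done₂′ step ; e₂⊑e₁ = below step
      ; coloured = coloured′ ; compared = compared′ }
      where
      elements′ : ∀ {s} → D′ s ≡ true → 1 ≤ s × s ≤ n
      elements′ {s} Ds with insert⁻ t D s Ds
      ... | inj₁ refl = 1≤t , t≤n
      ... | inj₂ (_ , Ds′) = elements Ds′
      done₁′ : ∀ {f₁ f₂ y j} → Step e₁ e₂ t f₁ f₂ y j → f₁ ≡ 0 ⊎ D′ f₁ ≡ true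
      done₁′ (reject _ _) = end-old done₁
      done₁′ (first _)    = inj₂ (set-hit D t)
      done₁′ (second _ _) = inj₂ (set-hit D t)
      done₂′ : ∀ {f₁ f₂ y j} → Step e₁ e₂ t f₁ f₂ y j → f₂ ≡ 0 ⊎ D′ f₂ ≡ true
      done₂′ (reject _ _) = end-old done₂
      done₂′ (first _)    = end-old done₂
      done₂′ (second _ _) = end-old done₁
      below : ∀ {f₁ f₂ y j} → Step e₁ e₂ t f₁ f₂ y j → f₂ ⊑ f₁
      below (reject _ _) = e₂⊑e₁
      below (first _)    = end⊑t done₂
      below (second _ _) = end⊑t done₁

-- The selection scan and the complete program

-- Natural arrays: 11 and 12 the last elements of the two tracks, 13 the marks of the
-- elements (0, or one more than the parity of the class if accepted), 14 the number
-- of accepted elements of each parity, 15 the mark to be output.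

end₁ end₂ : NatExp
end₁ = nat[ 11 ][ lit 0 ]
end₂ = nat[ 12 ][ lit 0 ]

mark tallyOf : NatExp → NatExp
mark    = nat[ 13 ][_]
tallyOf = nat[ 14 ][_]

byRight : NatExp → NatExp → BoolExp
byRight a b = lexᵉ (classOf a) (rightᵉ a) (classOf b) (rightᵉ b)

-- With the class as leading key, an end in an earlier class never blocks. Every class thus starts
-- on tracks that are free in effect, and one scan serves all classes.
blocksᵉ : NatExp → BoolExp
blocksᵉ e = (lit 1 ≤ⁿ e) & lexᵉ (classOf current) (leftᵉ current) (classOf e) (rightᵉ e)

accept : Program
accept =
  nat[ 11 ][ lit 0 ]≔ current ⨾
  nat[ 13 ][ current ]≔ lit 1 ⊕ parityOf current ⨾
  nat[ 14 ][ parityOf current ]≔ lit 1 ⊕ tallyOf (parityOf current)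

select : Program
select =
  ifᵖ blocksᵉ end₁
  then (ifᵖ blocksᵉ end₂
        then nat[ 13 ][ current ]≔ lit 0
        else (nat[ 12 ][ lit 0 ]≔ end₁ ⨾ accept))
  else accept

-- The invariant of the first scan is silent about these cells, so the starting state of the greedy
-- is established here.
reset : Program
reset =
  nat[ 11 ][ lit 0 ]≔ lit 0 ⨾
  nat[ 12 ][ lit 0 ]≔ lit 0 ⨾
  nat[ 14 ][ lit 0 ]≔ lit 0 ⨾
  nat[ 14 ][ lit 1 ]≔ lit 0

majority : Program
majority =
  ifᵖ tallyOf (lit 0) ≤ⁿ tallyOf (lit 1)
  then nat[ 15 ][ lit 0 ]≔ lit 2
  else nat[ 15 ][ lit 0 ]≔ lit 1

reportStep : Program
reportStep =
  (ifᵖ (mark pointer ≤ⁿ nat[ 15 ][ lit 0 ]) & (nat[ 15 ][ lit 0 ] ≤ⁿ mark pointer)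
   then nat[ 1 ][ pointer ⊖ lit 1 ]≔ lit 1
   else nat[ 1 ][ pointer ⊖ lit 1 ]≔ lit 0) ⨾
  nat[ 4 ][ lit 0 ]≔ pointer ⊖ lit 1

report : Program
report =
  nat[ 4 ][ lit 0 ]≔ nat[ 0 ][ lit 0 ] ⨾
  while lit 1 ≤ⁿ pointer loop reportStep

algorithm : Program
algorithm =
  tournament byBottom classify ⨾
  reset ⨾
  tournament byRight select ⨾
  majority ⨾
  report

module Selection
  (ℝ : RealNumbers) (ρ : ℕ → ℕ → RealNumbers.Carrier ℝ) (n : ℕ) (cls : ℕ → ℕ) where

  open Machine ℝ ρ
  open Reals ℝ

  leftOf rightOf : ℕ → Carrier
  leftOf s  = ρ 0 (s ∸ 1)
  rightOf s = ρ 1 (s ∸ 1)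

  before blocks : ℕ → ℕ → Bool
  before s t = lex (cls s) (rightOf s) (cls t) (rightOf t)
  blocks e t = (1 ≤ᵇ e) ∧ lex (cls t) (leftOf t) (cls e) (rightOf e)

  open Greedy n before blocks (λ _ → refl) public

  blocks⁻ : ∀ {e t} → blocks e t ≡ true → 1 ≤ e × lex (cls t) (leftOf t) (cls e) (rightOf e) ≡ true
  blocks⁻ {suc e} h = s≤s z≤n , h

  -- Whatever starts no later than the end of `s` starts no later than the end of `t`, by
  -- transitivity of the lexicographic order; `1 ≤ t` excludes the empty track.
  before⇒⊑ : ∀ {s t} → 1 ≤ t → before s t ≡ true → s ⊑ t
  before⇒⊑ {s} {suc t} _ h u b = lex-trans {cls u} {leftOf u} {cls s} {rightOf s} {cls (suc t)} {rightOf (suc t)}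
    (proj₂ (blocks⁻ {s} {u} b)) h

  -- `class-is` freezes the class array as the first scan left it, which makes `before` and `blocks`
  -- fixed relations. The greedy's count of accepted elements is split into the two tallies by
  -- parity.
  record SelectedIn (D : ℕ → Bool) (c par : ℕ → ℕ) (e₁ e₂ : ℕ) (sel tally : ℕ → ℕ) : Set where
    field
      class-is  : c ≡ cls
      parity-is : ∀ {s} → 1 ≤ s → s ≤ n → par s ≡ parityBit (cls s)
      greedy    : Invariant D sel (tally 0 + tally 1) e₁ e₂
      marks     : ∀ {s} → D s ≡ true → sel s ≡ 0 ⊎ sel s ≡ suc (parityBit (cls s))
      tallies   : ∀ {p} → p ≤ 1 → tally p ≡ count (suc n) (λ s → D s ∧ (sel s ≡ᵇ suc p))

  Selected : (ℕ → Bool) → Nats → Set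
  Selected D m = SelectedIn D (m 6) (m 7) (m 11 0) (m 12 0) (m 13) (m 14)

  module _ {D c par e₁ e₂ sel tally t} (s : SelectedIn D c par e₁ e₂ sel tally)
    (1≤t : 1 ≤ t) (t≤n : t ≤ n) (Dt : D t ≡ false)
    (before-t : ∀ s → D s ≡ true → before s t ≡ true) where

    open SelectedIn s

    private
      advance : ∀ {e₁′ e₂′ x k} → Step e₁ e₂ t e₁′ e₂′ x k →
                Invariant (insert t D) (set sel t x) (k + (tally 0 + tally 1)) e₁′ e₂′
      advance = invariant-step greedy 1≤t t≤n Dt (λ {s} → before-t s)
                  (λ {s} Ds → before⇒⊑ {s} {t} 1≤t (before-t s Ds))

      marks′ : ∀ {x} → (x ≡ 0 ⊎ x ≡ suc (parityBit (cls t))) →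
               ∀ {s} → insert t D s ≡ true → set sel t x s ≡ 0 ⊎ set sel t x s ≡ suc (parityBit (cls s))
      marks′ {x} h {s} Ds with insert⁻ t D s Ds
      ... | inj₁ refl rewrite set-hit sel t {x} = h
      ... | inj₂ (s≢t , Ds′) rewrite set-miss sel {x = x} (s≢t ∘ sym) = marks Ds′

      tallies′ : ∀ x {p} → count (suc n) (λ s → insert t D s ∧ (set sel t x s ≡ᵇ suc p))
                           ≡ bit (x ≡ᵇ suc p) + count (suc n) (λ s → D s ∧ (sel s ≡ᵇ suc p))
      tallies′ x {p} = trans
        (count-insert D {λ s → sel s ≡ᵇ suc p} {λ s → set sel t x s ≡ᵇ suc p} (s≤s t≤n) Dt (λ s t≢s → cong (_≡ᵇ suc p) (set-miss sel t≢s)))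
        (cong (λ y → bit (y ≡ᵇ suc p) + count (suc n) (λ s → D s ∧ (sel s ≡ᵇ suc p))) (set-hit sel t))

    selected-reject : Step e₁ e₂ t e₁ e₂ 0 0 →
                      SelectedIn (insert t D) c par e₁ e₂ (set sel t 0) tally
    selected-reject step = record
      { class-is = class-is ; parity-is = parity-is
      ; greedy = advance step
      ; marks = marks′ (inj₁ refl)
      ; tallies = λ p≤1 → trans (tallies p≤1) (sym (tallies′ 0)) }

    selected-accept : ∀ {e₁′ e₂′} → Step e₁ e₂ t e₁′ e₂′ (suc (par t)) 1 →
      SelectedIn (insert t D) c par e₁′ e₂′ (set sel t (suc (par t)))
                 (set tally (par t) (suc (tally (par t))))
    selected-accept {e₁′} {e₂′} step = record
      { class-is = class-is ; parity-is = parity-is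
      ; greedy = subst (λ c′ → Invariant (insert t D) (set sel t (suc (par t))) c′ e₁′ e₂′) (sym (total (par t) par-t)) (advance step)
      ; marks = marks′ (inj₂ (cong suc (parity-is 1≤t t≤n)))
      ; tallies = λ {p} p≤1 → trans (tally-step p) (trans (cong (bit (par t ≡ᵇ p) +_) (tallies p≤1)) (sym (tallies′ (suc (par t)) {p})))
      }
      where
      par-t : par t ≡ 0 ⊎ par t ≡ 1
      par-t rewrite parity-is 1≤t t≤n = parity-cases (cls t)
      total : ∀ q → q ≡ 0 ⊎ q ≡ 1 →
              set tally q (suc (tally q)) 0 + set tally q (suc (tally q)) 1 ≡ suc (tally 0 + tally 1)
      total .0 (inj₁ refl) = refl
      total .1 (inj₂ refl) = +-suc (tally 0) (tally 1)
      tally-step : ∀ p → set tally (par t) (suc (tally (par t))) p ≡ bit (par t ≡ᵇ p) + tally p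
      tally-step p with par t ≡ᵇ p in eq
      ... | true  = cong (suc ∘ tally) (≡ᵇ-true eq)
      ... | false = refl

  eval-blocks : ∀ {m} e → m 6 ≡ cls →
                holds (blocksᵉ e) m ≡ blocks (value e m) (m 5 0)
  eval-blocks {m} e class-is =
    cong (λ f → (1 ≤ᵇ value e m) ∧
      lex (f (m 5 0)) (leftOf (m 5 0)) (f (value e m)) (rightOf (value e m))) class-is

  eval-before : ∀ {m} → m 6 ≡ cls → ∀ a b →
                holds (byRight a b) m ≡ before (value a m) (value b m)
  eval-before {m} class-is a b =
    cong (λ f → lex (f (value a m)) (rightOf (value a m))
                    (f (value b m)) (rightOf (value b m))) class-is

  select-correct : ∀ {D m t} → Selected D m → m 5 0 ≡ t → 1 ≤ t → t ≤ n → D t ≡ false →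
    (∀ s → D s ≡ true → before s t ≡ true) →
    Run select m (flatCost select) λ m′ →
      Selected (insert t D) m′ × m′ 0 ≡ m 0 × m′ 2 ≡ m 2 × m′ 3 ≡ m 3 × m′ 5 ≡ m 5
  select-correct {D} {m} {t} s refl 1≤t t≤n Dt before-t =
    run-if (eval-blocks {m} end₁ class-is)
      (λ b₁ → run-if (eval-blocks {m} end₂ class-is)
        (λ b₂ → run-≔ refl refl (rejected (reject b₁ b₂) , refl , refl , refl , refl))
        (λ b₂ → run-⨾ (run-≔ refl refl (run-⨾ (run-≔ refl refl (run-⨾ (run-≔ refl refl (run-≔ refl refl
          (accepted (second b₁ b₂) , refl , refl , refl , refl)))))))))
      (λ b₁ → run-⨾ (run-≔ refl refl (run-⨾ (run-≔ refl refl (run-≔ refl refl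
        (accepted (first b₁) , refl , refl , refl , refl))))))
    where
    open SelectedIn s
    rejected = selected-reject {D} {m 6} {m 7} {m 11 0} {m 12 0} {m 13} {m 14} {t} s 1≤t t≤n Dt before-t
    accepted : ∀ {e₁′ e₂′} → Step (m 11 0) (m 12 0) t e₁′ e₂′ (suc (m 7 t)) 1 →
      SelectedIn (insert t D) (m 6) (m 7) e₁′ e₂′ (set (m 13) t (suc (m 7 t)))
                 (set (m 14) (m 7 t) (suc (m 14 (m 7 t))))
    accepted {e₁′} {e₂′} = selected-accept {D} {m 6} {m 7} {m 11 0} {m 12 0} {m 13} {m 14} {t} s 1≤t t≤n Dt before-t {e₁′} {e₂′}

-- Writing the output

reportCost : ℕ → ℕ
reportCost n = 4 + (n * (costᵇ (lit 1 ≤ⁿ pointer) + flatCost reportStep) + costᵇ (lit 1 ≤ⁿ pointer))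

module Reporting
  (ℝ : RealNumbers) (ρ : ℕ → ℕ → RealNumbers.Carrier ℝ) (n : ℕ) where

  open Machine ℝ ρ

  record Reported (m₀ : Nats) (i : ℕ) (m : Nats) : Set where
    field
      at       : m 4 0 ≡ i
      bound    : i ≤ n
      same     : m 13 ≡ m₀ 13
      same′    : m 15 0 ≡ m₀ 15 0
      reported : ∀ j → i ≤ j → j < n → (m 1 j ≡ᵇ 1) ≡ (m₀ 13 (suc j) ≡ᵇ m₀ 15 0)

  equal-correct : ∀ a b → ((a ≤ᵇ b) ∧ (b ≤ᵇ a)) ≡ (a ≡ᵇ b)
  equal-correct a b with <-cmp a b
  ... | tri≈ _ refl _ rewrite true-≤ᵇ (≤-refl {a}) | ≡ᵇ-refl a = refl
  ... | tri< a<b a≢b _ rewrite true-≤ᵇ (<⇒≤ a<b) | ≢⇒≡ᵇ-false a≢b with b ≤ᵇ a in eq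
  ...   | false = refl
  ...   | true  = ⊥-elim (<⇒≱ a<b (≤ᵇ-true eq))
  equal-correct a b | tri> _ a≢b b<a rewrite ≢⇒≡ᵇ-false a≢b with a ≤ᵇ b in eq
  ...   | false = refl
  ...   | true  = ⊥-elim (<⇒≱ b<a (≤ᵇ-true eq))

  report-step : ∀ {m₀ i m} → Reported m₀ (suc i) m →
                Run reportStep m (flatCost reportStep) (Reported m₀ i)
  report-step {m₀} {i} {m} r =
    run-⨾ (run-if {β = m₀ 13 (suc i) ≡ᵇ m₀ 15 0} test
      (λ h → run-≔ {i′ = i} {x = 1} (cong (_∸ 1) at) refl (run-≔ {x = i} refl (cong (_∸ 1) at) (next 1 h)))
      (λ h → run-≔ {i′ = i} {x = 0} (cong (_∸ 1) at) refl (run-≔ {x = i} refl (cong (_∸ 1) at) (next 0 h))))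
    where
    open Reported r
    test : ((m 13 (m 4 0) ≤ᵇ m 15 0) ∧ (m 15 0 ≤ᵇ m 13 (m 4 0))) ≡ (m₀ 13 (suc i) ≡ᵇ m₀ 15 0)
    test rewrite at | same | same′ = equal-correct (m₀ 13 (suc i)) (m₀ 15 0)
    next : ∀ x → (m₀ 13 (suc i) ≡ᵇ m₀ 15 0) ≡ (x ≡ᵇ 1) → Reported m₀ i ((m [ 1 , i ↦ x ]) [ 4 , 0 ↦ i ])
    next x h = record
      { at = refl ; bound = ≤-trans (n≤1+n i) bound ; same = same ; same′ = same′ ; reported = reported′ }
      where
      reported′ : ∀ j → i ≤ j → j < n → (set (m 1) i x j ≡ᵇ 1) ≡ (m₀ 13 (suc j) ≡ᵇ m₀ 15 0)
      reported′ j i≤j j<n with i ≟ j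
      ... | yes refl rewrite set-hit (m 1) i {x} = sym h
      ... | no i≢j rewrite set-miss (m 1) {x = x} i≢j = reported j (≤∧≢⇒< i≤j i≢j) j<n

  report-correct : ∀ {m} → m 0 0 ≡ n →
    Run report m (reportCost n) λ m′ → ∀ j → j < n → (m′ 1 j ≡ᵇ 1) ≡ (m 13 (suc j) ≡ᵇ m 15 0)
  report-correct {m} size = run-⨾ (run-≔ {x = n} refl size
    (run-while (Reported m)
      (λ { {zero} r g → ⊥-elim (<⇒≱ (≤ᵇ-true g) (≤-reflexive (Reported.at r)))
         ; {suc i} r g → i , refl , report-step r })
      (λ { {zero} r g j j<n → Reported.reported r j z≤n j<n
         ; {suc i} r g → ⊥-elim (<⇒≱ (≤ᵇ-false g) (subst (1 ≤_) (sym (Reported.at r)) (s≤s z≤n))) })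
      {r = n}
      (record { at = refl ; bound = ≤-refl ; same = refl ; same′ = refl
              ; reported = λ j n≤j j<n → ⊥-elim (<⇒≱ j<n n≤j) })))

-- The running time

private
  K : ℕ → ℕ
  K n = suc ⌊log₂ n ⌋

n<2^K : ∀ n → n < 2 ^ K n
n<2^K n = ≰⇒> λ 2^K≤n →
  <-irrefl refl (subst (_≤ ⌊log₂ n ⌋) (⌊log₂[2^n]⌋≡n (K n)) (⌊log₂⌋-mono-≤ 2^K≤n))

classifyCost selectCost time : ℕ → ℕ
classifyCost n = tournamentCost byBottom (flatCost classify) n (K n)
selectCost n   = tournamentCost byRight (flatCost select) n (K n)
time n =
  classifyCost n + (flatCost reset + (selectCost n + (flatCost majority + reportCost n)))

-- `suc n * K n` is positive for every `n`, so constants are absorbed and bounds added without a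
-- threshold.
Bounded : (ℕ → ℕ) → Set
Bounded f = ∃[ c ] ∀ n → f n ≤ c * (suc n * K n)

bounded-+ : ∀ {f g} → Bounded f → Bounded g → Bounded (λ n → f n + g n)
bounded-+ (c , h) (d , k) = c + d , λ n →
  ≤-trans (+-mono-≤ (h n) (k n)) (≤-reflexive (sym (*-distribʳ-+ (suc n * K n) c d)))

bounded-linear : ∀ a b d → Bounded (λ n → a + suc n * (b + K n * d))
bounded-linear a b d = a + (b + d) , λ n → ≤-trans
  (+-mono-≤ (m≤m*n a (suc n * K n))
    (*-monoʳ-≤ (suc n) (+-monoˡ-≤ (K n * d) (m≤m*n b (K n)))))
  (≤-reflexive (rearrange a b d (suc n) (K n)))
  where
  rearrange : ∀ a b d x y → a * (x * y) + x * (b * y + y * d) ≡ (a + (b + d)) * (x * y)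
  rearrange = solve-∀

bounded-by-linear : ∀ {f} a b d → (∀ n → f n ≤ a + suc n * (b + K n * d)) → Bounded f
bounded-by-linear a b d h =
  proj₁ (bounded-linear a b d) , λ n → ≤-trans (h n) (proj₂ (bounded-linear a b d) n)

bounded-tournament : ∀ cmp v → Bounded (λ n → tournamentCost cmp v n (K n))
bounded-tournament cmp v = shape
  (costᵇ (lit 1 ≤ⁿ pointer) + flatCost (buildStep cmp)) (costᵇ (lit 1 ≤ⁿ pointer))
  (costᵇ (lit 1 ≤ⁿ tree (lit 1))) (costᵇ (lit 1 ≤ⁿ pointer) + flatCost (siftStep cmp))
  where
  rearrange : ∀ v N k x g y z → 11 + ((N + N) * x + g + (N * (y + (4 + (v + (9 + (10 + (k * z + g)))))) + y))
                                ≡ 11 + g + y + N * (x + x + y + v + g + 23 + k * z)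
  rearrange = solve-∀
  -- The costs that depend on the program text are generalised to variables, which turns the
  -- required identity into a polynomial one.
  shape : ∀ x g y z → Bounded λ n →
    11 + ((suc n + suc n) * x + g + (suc n * (y + (4 + (v + (9 + (10 + (K n * z + g)))))) + y))
  shape x g y z = bounded-by-linear (11 + g + y) (x + x + y + v + g + 23) z λ n →
    ≤-reflexive (rearrange v (suc n) (K n) x g y z)

bounded-report : Bounded reportCost
bounded-report = shape (costᵇ (lit 1 ≤ⁿ pointer) + flatCost reportStep) (costᵇ (lit 1 ≤ⁿ pointer))
  where
  rearrange : ∀ N k x g → 4 + (N * x + g) ≡ 4 + g + N * (x + k * 0)
  rearrange = solve-∀
  shape : ∀ x g → Bounded λ n → 4 + (n * x + g)
  shape x g = bounded-by-linear (4 + g) x 0 λ n →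
    ≤-trans (+-monoʳ-≤ 4 (+-monoˡ-≤ g (*-monoˡ-≤ x (n≤1+n n)))) (≤-reflexive (rearrange (suc n) (K n) x g))

time-bounded : Bounded time
time-bounded =
  bounded-+ {classifyCost} {λ n → flatCost reset + (selectCost n + (flatCost majority + reportCost n))}
    (bounded-tournament byBottom (flatCost classify))
  (bounded-+ {λ _ → flatCost reset} {λ n → selectCost n + (flatCost majority + reportCost n)}
    (bounded-constant (flatCost reset))
  (bounded-+ {selectCost} {λ n → flatCost majority + reportCost n}
    (bounded-tournament byRight (flatCost select))
  (bounded-+ {λ _ → flatCost majority} {reportCost}
    (bounded-constant (flatCost majority)) bounded-report)))
  where
  bounded-constant : ∀ a → Bounded (λ _ → a)
  bounded-constant a = a , λ n → m≤m*n a (suc n * K n)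

bounded⇒∈O : ∀ {f} → Bounded f → f ∈O (λ n → n * ⌊log₂ n ⌋)
-- From 2 on the logarithm is at least 1, so adding 1 at most doubles `n` and the logarithm; this
-- gives the factor 4.
bounded⇒∈O (c , h) = c * 4 , 2 , λ n 2≤n →
  let L≥1 = ⌊log₂⌋-mono-≤ 2≤n in
  ≤-trans (h n) (≤-trans
    (*-monoʳ-≤ c (*-mono-≤ (+-monoˡ-≤ n (≤-trans (n≤1+n 1) 2≤n)) (+-monoˡ-≤ ⌊log₂ n ⌋ L≥1)))
    (≤-reflexive (rearrange c n ⌊log₂ n ⌋)))
  where
  rearrange : ∀ c n l → c * ((n + n) * (l + l)) ≡ c * 4 * (n * l)
  rearrange = solve-∀

-- From intervals back to rectangles

∣∣≡count : ∀ {n} (U : Subset n) (f : ℕ → Bool) → (∀ i → f (toℕ i) ≡ lookup U i) → ∣ U ∣ ≡ count n f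
∣∣≡count []          f h = refl
∣∣≡count (true ∷ U)  f h rewrite h zero = cong suc (∣∣≡count U (f ∘ suc) (h ∘ suc))
∣∣≡count (false ∷ U) f h rewrite h zero = ∣∣≡count U (f ∘ suc) (h ∘ suc)

module Correctness (ℝ : RealNumbers) {n : ℕ} (S : Rectangles.RectangleSet ℝ n) where

  open Rectangles ℝ
  open UnitHeightRectangle
  open RectangleSet S
  open Reals ℝ

  ρ : ℕ → ℕ → Carrier
  ρ = realMem (input S)

  open Machine ℝ ρ
  open Classification ℝ ρ

  element : ∀ {s} → 1 ≤ s → s ≤ n → ∃[ i ] s ≡ suc (toℕ {n} i)
  element {suc k} _ k<n = fromℕ< k<n , cong suc (sym (toℕ-fromℕ< k<n))

  coordinate-toℕ : ∀ f i → coordinate S f (toℕ i) ≡ f (rect i)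
  coordinate-toℕ f i with toℕ i <? n
  ... | yes i<n = cong (f ∘ rect) (fromℕ<-toℕ i i<n)
  ... | no i≮n  = ⊥-elim (i≮n (toℕ<n i))

  -- The common point lies on the right edge of `r`, at the height of the higher of the two bottom
  -- edges.
  meets : ∀ r s → bottom r ≤ᴿ top s → bottom s ≤ᴿ top r →
            left s ≤ᴿ right r → right r ≤ᴿ right s → Intersect r s
  meets r s r≤s s≤r l≤r r≤r with ≤ᴿ-total (bottom r) (bottom s)
  ... | inj₁ h = right r , bottom s
    , (proj₁ (left<right r) , ≤ᴿ-refl , h , s≤r)
    , (l≤r , r≤r , ≤ᴿ-refl , x≤x+1 (bottom s))
  ... | inj₂ h = right r , bottom r
    , (proj₁ (left<right r) , ≤ᴿ-refl , ≤ᴿ-refl , x≤x+1 (bottom r))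
    , (l≤r , r≤r , h , r≤s)

  extend : (Fin n → Bool) → ℕ → Bool
  extend f zero = false
  extend f (suc k) with k <? n
  ... | yes k<n = f (fromℕ< k<n)
  ... | no _    = false

  extend-toℕ : ∀ f i → extend f (suc (toℕ i)) ≡ f i
  extend-toℕ f i with toℕ i <? n
  ... | yes i<n = cong f (fromℕ<-toℕ i i<n)
  ... | no i≮n  = ⊥-elim (i≮n (toℕ<n i))

  module Grouped (cls : ℕ → ℕ)
    (near : ∀ i j → cls (suc (toℕ i)) ≡ cls (suc (toℕ j)) → bottom (rect i) ≤ᴿ top (rect j))
    (apart : ∀ i j → 2 + cls (suc (toℕ i)) ≤ cls (suc (toℕ j)) → ¬ bottom (rect j) ≤ᴿ top (rect i))
    where

    open Selection ℝ ρ n cls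

    -- If `s` comes before `t` and yet blocks it, both have the same class and their x-intervals
    -- meet. By `near` the rectangles then intersect, which a proper colouring forbids within one
    -- colour.
    solution : ∀ U → BipartiteSubset S U → Solution
    solution U (side , proper) = record
      { member = extend (lookup U) ; side = extend sideOf ; compatible = compatible }
      where
      sideOf : Fin n → Bool
      sideOf i with i ∈? U
      ... | yes i∈U = side (i , i∈U)
      ... | no _    = false
      sideOf-∈ : ∀ i → lookup U i ≡ true → ∃[ i∈U ] sideOf i ≡ side (i , i∈U)
      sideOf-∈ i Ui with i ∈? U
      ... | yes i∈U = i∈U , refl
      ... | no i∉U  = ⊥-elim (i∉U (lookup⇒[]= i U Ui))
      compatible : ∀ {s t} → 1 ≤ s → s ≤ n → 1 ≤ t → t ≤ n → s ≢ t →
                   extend (lookup U) s ≡ true → extend (lookup U) t ≡ true →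
                   extend sideOf s ≡ extend sideOf t → before s t ≡ true → blocks s t ≡ false
      compatible {s} {t} 1≤s s≤n 1≤t t≤n s≢t Us Ut same s<t with blocks s t in blocked
      ... | false = refl
      ... | true with element 1≤s s≤n | element 1≤t t≤n
      ...   | i , refl | j , refl
        with sideOf-∈ i (trans (sym (extend-toℕ (lookup U) i)) Us)
           | sideOf-∈ j (trans (sym (extend-toℕ (lookup U) j)) Ut)
      ...     | i∈U , si | j∈U , sj = ⊥-elim (proper (i , i∈U) (j , j∈U)
          (s≢t ∘ cong (suc ∘ toℕ) , meet)
          (trans (sym si) (trans (sym (extend-toℕ sideOf i)) (trans same (trans (extend-toℕ sideOf j) sj)))))
        where
        lex₁ : cls (suc (toℕ j)) < cls (suc (toℕ i)) ⊎
               (cls (suc (toℕ j)) ≡ cls (suc (toℕ i)) × ρ 0 (toℕ j) ≤ᴿ ρ 1 (toℕ i))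
        lex₁ = lex⁻ {cls (suc (toℕ j))} {ρ 0 (toℕ j)} {cls (suc (toℕ i))} {ρ 1 (toℕ i)} blocked
        lex₂ : cls (suc (toℕ i)) < cls (suc (toℕ j)) ⊎
               (cls (suc (toℕ i)) ≡ cls (suc (toℕ j)) × ρ 1 (toℕ i) ≤ᴿ ρ 1 (toℕ j))
        lex₂ = lex⁻ {cls (suc (toℕ i))} {ρ 1 (toℕ i)} {cls (suc (toℕ j))} {ρ 1 (toℕ j)} s<t
        meet : Intersect (rect i) (rect j)
        meet with lex₁ | lex₂
        ... | inj₁ lt      | inj₁ gt      = ⊥-elim (<-asym lt gt)
        ... | inj₁ lt      | inj₂ (e , _) = ⊥-elim (<⇒≢ lt (sym e))
        ... | inj₂ (e , _) | inj₁ lt      = ⊥-elim (<⇒≢ lt (sym e))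
        ... | inj₂ (e , l≤r) | inj₂ (e′ , r≤r) = meets (rect i) (rect j) (near i j e′) (near j i e)
          (subst₂ _≤ᴿ_ (coordinate-toℕ left j) (coordinate-toℕ right i) l≤r)
          (subst₂ _≤ᴿ_ (coordinate-toℕ right i) (coordinate-toℕ right j) r≤r)

    module _ {D c par e₁ e₂ sel tally} (sd : SelectedIn D c par e₁ e₂ sel tally)
             (full : ∀ s → 1 ≤ s → s ≤ n → D s ≡ true) where

      open SelectedIn sd
      open Invariant greedy
      open Coloured coloured

      full-element : ∀ (i : Fin n) → D (suc (toℕ i)) ≡ true
      full-element i = full (suc (toℕ i)) (s≤s z≤n) (toℕ<n i)

      count-full : ∀ P → count (suc n) (λ s → D s ∧ P s) ≡ count n (P ∘ suc)
      count-full P with D 0 in D0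
      -- The visited set contains elements only, so the dummy index 0 contributes nothing.
      ... | true with () ← proj₁ (elements D0)
      ... | false = count-cong n λ s s<n → cong (_∧ P (suc s)) (full (suc s) (s≤s z≤n) s<n)

      -- With every element visited, the rival's count is the whole of `U`, and each case of `Ahead`
      -- contains the inequality.
      optimal : ∀ U → BipartiteSubset S U → ∣ U ∣ ≤ tally 0 + tally 1
      optimal U bip with compared (solution U bip)
      ... | _ , _ , a = subst (_≤ tally 0 + tally 1)
        (trans (count-full (extend (lookup U)))
               (sym (∣∣≡count U (extend (lookup U) ∘ suc) (extend-toℕ (lookup U)))))
        (ahead⇒≤ a)

      module _ {p} (p≤1 : p ≤ 1) (T : Subset n)
               (T-marks : ∀ i → lookup T i ≡ (sel (suc (toℕ i)) ≡ᵇ suc p)) where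

        size : ∣ T ∣ ≡ tally p
        size = trans (∣∣≡count T (λ k → sel (suc k) ≡ᵇ suc p) (sym ∘ T-marks))
                 (sym (trans (tallies p≤1) (count-full (λ s → sel s ≡ᵇ suc p))))

        bipartite : BipartiteSubset S T
        bipartite = (λ (i , _) → colour (suc (toℕ i))) ,
          λ (i , i∈T) (j , j∈T) (i≢j , meet) same → conflict i j i∈T j∈T i≢j meet same
          where
          marked : ∀ i → i ∈ T → sel (suc (toℕ i)) ≡ suc p
          marked i i∈T = ≡ᵇ-true (trans (sym (T-marks i)) ([]=⇒lookup i∈T))
          chosen : ∀ i → i ∈ T → Chosen D sel (suc (toℕ i))
          chosen i i∈T = full-element i , subst (1 ≤_) (sym (marked i i∈T)) (s≤s z≤n)
          parity-p : ∀ i → i ∈ T → parityBit (cls (suc (toℕ i))) ≡ p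
          parity-p i i∈T with marks (full-element i)
          ... | inj₁ z with () ← trans (sym z) (marked i i∈T)
          ... | inj₂ e = suc-injective (trans (sym e) (marked i i∈T))
          far : ∀ i j → i ∈ T → j ∈ T → cls (suc (toℕ i)) < cls (suc (toℕ j)) →
                ¬ Intersect (rect i) (rect j)
          far i j i∈T j∈T lt (_ , y , (_ , _ , _ , y≤) , (_ , _ , ≤y , _)) =
            -- Equal parity rules out consecutive classes, so the classes differ by at least 2.
            apart i j (≤∧≢⇒< lt step) (≤ᴿ-trans ≤y y≤)
            where
            step : suc (cls (suc (toℕ i))) ≢ cls (suc (toℕ j))
            step e = parity-suc (cls (suc (toℕ i)))
              (trans (cong parityBit e) (trans (parity-p j j∈T) (sym (parity-p i i∈T))))
          blocked : ∀ i j → cls (suc (toℕ i)) ≡ cls (suc (toℕ j)) →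
                    Intersect (rect i) (rect j) → blocks (suc (toℕ i)) (suc (toℕ j)) ≡ true
          blocked i j e (x , _ , (_ , x≤ , _) , (≤x , _)) rewrite e =
            lex-≡ {cls (suc (toℕ j))} {ρ 0 (toℕ j)} {ρ 1 (toℕ i)}
              (subst₂ _≤ᴿ_ (sym (coordinate-toℕ left j)) (sym (coordinate-toℕ right i)) (≤ᴿ-trans ≤x x≤))
          swap : ∀ i j → Intersect (rect i) (rect j) → Intersect (rect j) (rect i)
          swap i j (x , y , p , q) = x , y , q , p
          conflict : ∀ i j → i ∈ T → j ∈ T → i ≢ j → Intersect (rect i) (rect j) →
                     colour (suc (toℕ i)) ≡ colour (suc (toℕ j)) → ⊥
          conflict i j i∈T j∈T i≢j meet same
            with <-cmp (cls (suc (toℕ i))) (cls (suc (toℕ j)))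
          ... | tri< lt _ _ = far i j i∈T j∈T lt meet
          ... | tri> _ _ gt = far j i j∈T i∈T gt (swap i j meet)
          -- Intersection is symmetric, so within a class each of the two blocks the other; this
          -- refutes either alternative offered by `free`.
          ... | tri≈ _ e _ with free (chosen i i∈T) (chosen j j∈T) (i≢j ∘ toℕ-injective ∘ suc-injective) same
          ...   | inj₁ fr = true≢false (blocked i j e meet) fr
          ...   | inj₂ fr = true≢false (blocked j i (sym e) (swap i j meet)) fr

  Good : Nats → Set
  Good m = BipartiteSubset S (output n ⟪ m , ρ ⟫) ×
           (∀ S* → MaximumBipartiteSubset S S* → ∣ S* ∣ ≤ 2 * ∣ output n ⟪ m , ρ ⟫ ∣)

  algorithm-correct : Run algorithm (natMem (input S)) (time n) Good
  algorithm-correct =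
    run-⨾ (run-mono (λ { m₁ (size₁ , D₁ , cl , full₁) →
      run-⨾ (run-⨾ (run-≔ refl refl (run-⨾ (run-≔ refl refl (run-⨾ (run-≔ refl refl (run-≔ refl refl
        (second-half m₁ D₁ size₁ cl full₁)))))))) })
      (Tournament.tournament-correct ℝ ρ n byBottom
        (λ a b → does (bottomOf a ≤ᴿ? bottomOf b))
        (λ {a} {b} {c} h k → true-dec (bottomOf a ≤ᴿ? bottomOf c)
           (≤ᴿ-trans (dec-true (bottomOf a ≤ᴿ? bottomOf b) h) (dec-true (bottomOf b ≤ᴿ? bottomOf c) k)))
        (λ a b → [ inj₁ ∘ true-dec (bottomOf a ≤ᴿ? bottomOf b) , inj₂ ∘ true-dec (bottomOf b ≤ᴿ? bottomOf a) ]′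
           (≤ᴿ-total (bottomOf a) (bottomOf b)))
        Classified
        (λ { treeᵖ _ _ j → j ; halfᵖ _ _ j → j ; pointerᵖ _ _ j → j ; currentᵖ _ _ j → j })
        (λ _ _ _ → refl)
        classify (flatCost classify)
        (λ j at 1≤t _ _ least → classify-correct j at 1≤t least)
        {K = K n} (n<2^K n) refl nothing-classified))
    where
    nothing-classified : Classified (λ _ → false) (natMem (input S))
    nothing-classified = record
      { parity-now = refl ; parity-of = λ () ; base-set = λ () ; base-done = λ () ; class≤ = λ ()
      ; below = λ () ; above = λ () ; earlier = λ () ; far = λ () ; near = λ () ; apart = λ () }

    second-half : ∀ m₁ D₁ → m₁ 0 0 ≡ n → Classified D₁ m₁ → (∀ s → 1 ≤ s → s ≤ n → D₁ s ≡ true) →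
      Run (tournament byRight select ⨾ majority ⨾ report)
          ((((m₁ [ 11 , 0 ↦ 0 ]) [ 12 , 0 ↦ 0 ]) [ 14 , 0 ↦ 0 ]) [ 14 , 1 ↦ 0 ])
          (tournamentCost byRight (flatCost select) n (K n) + (flatCost majority + reportCost n))
          Good
    second-half m₁ D₁ size₁ cl full₁ =
      run-⨾ (run-mono (λ { m₂ (size₂ , D₂ , sd , full₂) → finish m₂ D₂ size₂ sd full₂ })
        (Tournament.tournament-correct ℝ ρ n byRight before
          (λ {a} {b} {c} → lex-trans {cls a} {rightOf a} {cls b} {rightOf b} {cls c} {rightOf c})
          (λ a b → lex-total (cls a) (rightOf a) (cls b) (rightOf b))
          Selected
          (λ { treeᵖ _ _ j → j ; halfᵖ _ _ j → j ; pointerᵖ _ _ j → j ; currentᵖ _ _ j → j })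
          (λ {D} {m} j → eval-before {m} (SelectedIn.class-is j))
          select (flatCost select)
          select-correct
          {K = K n} (n<2^K n) size₁ nothing-selected))
      where
      cls : ℕ → ℕ
      cls = m₁ 6
      open Selection ℝ ρ n cls
      module C = Classes cl
      full₁′ : ∀ (i : Fin n) → D₁ (suc (toℕ i)) ≡ true
      full₁′ i = full₁ (suc (toℕ i)) (s≤s z≤n) (toℕ<n i)
      open Grouped cls
        (λ i j e → subst₂ (λ x y → x ≤ᴿ y +ᴿ 1#) (coordinate-toℕ bottom i) (coordinate-toℕ bottom j)
                     (C.near (full₁′ i) (full₁′ j) e))
        (λ i j e h → C.apart (full₁′ i) (full₁′ j) e
                     (subst₂ (λ x y → x ≤ᴿ y +ᴿ 1#) (sym (coordinate-toℕ bottom j)) (sym (coordinate-toℕ bottom i)) h))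
      nothing-selected : SelectedIn (λ _ → false) cls (m₁ 7) 0 0 (m₁ 13) (set (set (m₁ 14) 0 0) 1 0)
      nothing-selected = record
        { class-is = refl
        ; parity-is = λ {s} 1≤s s≤n → C.parity-of (full₁ s 1≤s s≤n)
        ; greedy = start ; marks = λ ()
        ; tallies = λ { {zero} _ → sym (count-const-false n) ; {suc zero} _ → sym (count-const-false n)
                      ; {suc (suc _)} (s≤s ()) } }
      finish : ∀ m₂ D₂ → m₂ 0 0 ≡ n → Selected D₂ m₂ → (∀ s → 1 ≤ s → s ≤ n → D₂ s ≡ true) →
               Run (majority ⨾ report) m₂ (flatCost majority + reportCost n) Good
      finish m₂ D₂ size₂ sd full₂ =
        run-⨾ (run-if {β = m₂ 14 0 ≤ᵇ m₂ 14 1} refl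
          (λ h → run-≔ {x = 2} refl refl (deliver (≤-refl {1})
            (+-monoˡ-≤ (m₂ 14 1) (≤ᵇ-true h)) refl))
          (λ h → run-≔ {x = 1} refl refl (deliver {0} z≤n
            (+-monoʳ-≤ (m₂ 14 0) (<⇒≤ (≤ᵇ-false h))) refl)))
        where
        -- The sum of the tallies bounds every bipartite subset, by `optimal`; the chosen tally is
        -- at least half of that sum, and mark `suc p` picks out its elements.
        deliver : ∀ {p m₃} → p ≤ 1 → m₂ 14 0 + m₂ 14 1 ≤ m₂ 14 p + m₂ 14 p →
                  m₃ ≡ m₂ [ 15 , 0 ↦ suc p ] → Run report m₃ (reportCost n) Good
        deliver {p} p≤1 big refl = run-mono good (report-correct size₂)
          where
          open Reporting ℝ ρ n
          good : ∀ m → (∀ j → j < n → (m 1 j ≡ᵇ 1) ≡ (m₂ 13 (suc j) ≡ᵇ suc p)) → Good m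
          good m reported = bipartite sd full₂ p≤1 T T-marks , λ S* (bip , _) →
            ≤-trans (optimal sd full₂ S* bip)
              (≤-trans big (≤-reflexive (sym (trans (cong (2 *_) (size sd full₂ p≤1 T T-marks))
                (cong (m₂ 14 p +_) (+-identityʳ (m₂ 14 p)))))))
            where
            T : Subset n
            T = output n ⟪ m , ρ ⟫
            T-marks : ∀ i → lookup T i ≡ (m₂ 13 (suc (toℕ i)) ≡ᵇ suc p)
            T-marks i = trans (lookup∘tabulate (λ i → m 1 (toℕ i) ≡ᵇ 1) i) (reported (toℕ i) (toℕ<n i))

theorem12 : (ℝ : RealNumbers) → let open Rectangles ℝ in
    ∃[ algorithm ] ∃[ time ]
    (time ∈O (λ n → n * ⌊log₂ n ⌋)) ×
    (∀ n (S : RectangleSet n) →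
    ∃[ σ ] ∃[ t ]
    (algorithm , input S ⇓ σ , t) ×
    t ≤ time n ×
    BipartiteSubset S (output n σ) ×
    (∀ S* → MaximumBipartiteSubset S S* → ∣ S* ∣ ≤ 2 * ∣ output n σ ∣))
theorem12 ℝ = algorithm , time , bounded⇒∈O time-bounded , λ n S →
  let open Machine.Run (Correctness.algorithm-correct ℝ S) in
  _ , _ , halts , within , post
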